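{- For the online scheduling problem $R||\sum w_jC_j$, for every $\varepsilon>0$ and every deterministic online fractional algorithm there exists an instance with $\mathrm{OPT}>0$ on which the cost of the fractional solution produced by the algorithm is at least $(4-\varepsilon)\,\mathrm{OPT}$; that is, no fractional algorithm can be better than $4$-competitive.
   Context: Online problem $R||\sum w_jC_j$: a finite set of machines $M$ is given; jobs $J=\{1,\dots,n\}$ arrive in this order ($n$ not known in advance). When $j$ arrives it reveals a weight $w_j\ge0$, a nonempty set $\mathcal S_j\subseteq M$ of feasible machines, and processing times $p_{ij}\ge0$ for $i\in\mathcal S_j$. A deterministic online fractional algorithm then irrevocably chooses, as a function only of $M$ and the data revealed so far, $x_{ij}\in[0,1]$ with $\sum_{i\in\mathcal S_j}x_{ij}=1$ and $x_{ij}=0$ for $i\notin\mathcal S_j$. Once all jobs have arrived, every machine $i$ orders jobs by increasing Smith ratio $\delta_{ij}=p_{ij}/w_j$: $\prec_i$ denotes a strict total order of the jobs feasible on $i$ such that $k\prec_i j$ implies $\delta_{ik}\le\delta_{ij}$ (ties broken arbitrarily). The completion time of $j$ is $$C_j(x)=\sum_{i\in\mathcal S_j}x_{ij}\Big(p_{ij}+\sum_{k\prec_i j}p_{ik}x_{ik}\Big),$$ and the cost is $\sum_{j\in J}w_jC_j(x)$. $\mathrm{OPT}$ is the minimum of the cost over integral assignments ($x_{ij}\in\{0,1\}$). -}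

module Defs where

open import Level using (Level; _⊔_; suc)
open import Algebra.Bundles using (CommutativeRing)
open import Algebra.Structures using (IsCommutativeRing)
import Algebra.Properties.CommutativeMonoid.Mult as Multiplication
import Algebra.Properties.CommutativeMonoid.Sum as Sum
open import Data.Fin.Base as Fin using (Fin; toℕ)
import Data.Fin.Properties as Fin
open import Data.Fin.Subset using (Subset; _∈_; _∉_; Nonempty)
open import Data.Fin.Subset.Properties using (_∈?_)
open import Data.List.Base using (List; length; lookup; take)
open import Data.Nat.Base as ℕ using (ℕ)
open import Data.Product.Base using (∃; _×_; _,_; proj₁; proj₂)
import Data.Product.Relation.Binary.Lex.Strict as Lex
open import Data.Sum.Base using (_⊎_; inj₁; inj₂)
open import Function.Base using (_on_)
open import Relation.Binary.Core using (Rel)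
open import Relation.Binary.Definitions using (Trichotomous; tri<; tri≈; tri>)
open import Relation.Binary.PropositionalEquality.Core using (_≡_; _≢_; refl)
import Relation.Binary.PropositionalEquality.Properties as ≡
open import Relation.Binary.Structures using (IsDecTotalOrder; IsStrictTotalOrder)
import Relation.Binary.Construct.Add.Supremum.NonStrict as Supremum
import Relation.Binary.Construct.NonStrictToStrict as ToStrict
import Relation.Binary.Construct.On as On
open import Relation.Nullary.Construct.Add.Supremum using (_⁺; ⊤⁺; [_])
open import Relation.Nullary.Decidable.Core using (Dec; yes; no)

record OrderedField c ℓ : Set (suc (c ⊔ ℓ)) where
  infix  4 _≤_ _<_
  infixl 6 _+_
  infixl 7 _*_
  infix  8 -_
  infix  9 _⁻¹
  field
    ℝ                 : Set c
    _+_ _*_           : ℝ → ℝ → ℝ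
    -_                : ℝ → ℝ
    0ℝ 1ℝ             : ℝ
    _⁻¹               : ℝ → ℝ
    _≤_               : Rel ℝ ℓ
    isCommutativeRing : IsCommutativeRing _≡_ _+_ _*_ -_ 0ℝ 1ℝ
    0≢1               : 0ℝ ≢ 1ℝ
    -- 0ℝ ⁻¹ is an unspecified junk value.
    *-inverseʳ        : ∀ x → x ≢ 0ℝ → x * x ⁻¹ ≡ 1ℝ
    isDecTotalOrder   : IsDecTotalOrder _≡_ _≤_
    +-monoʳ-≤         : ∀ z {x y} → x ≤ y → z + x ≤ z + y
    *-nonneg          : ∀ {x y} → 0ℝ ≤ x → 0ℝ ≤ y → 0ℝ ≤ x * y

  commutativeRing : CommutativeRing c c
  commutativeRing = record { isCommutativeRing = isCommutativeRing }

  open CommutativeRing commutativeRing public using (_-_; +-commutativeMonoid)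
  open IsDecTotalOrder isDecTotalOrder public using (_≟_; _≤?_)
  private module Mult = Multiplication +-commutativeMonoid
  open Sum +-commutativeMonoid public using (sum)

  _<_ : Rel ℝ (c ⊔ ℓ)
  _<_ = ToStrict._<_ _≡_ _≤_

  fromℕ : ℕ → ℝ
  fromℕ n = n Mult.× 1ℝ

  Within : ℝ → ℝ → ℝ → Set ℓ
  Within ε x y = (x ≤ y + ε) × (y ≤ x + ε)

  Cauchy : (ℕ → ℝ) → Set (c ⊔ ℓ)
  Cauchy s = ∀ ε → 0ℝ < ε →
    ∃ λ N → ∀ m n → N ℕ.≤ m → N ℕ.≤ n → Within ε (s m) (s n)

  _⟶_ : (ℕ → ℝ) → ℝ → Set (c ⊔ ℓ)
  s ⟶ l = ∀ ε → 0ℝ < ε → ∃ λ N → ∀ n → N ℕ.≤ n → Within ε (s n) l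

-- The real numbers, axiomatised as a Cauchy-complete Archimedean ordered
-- field.  Classically these axioms determine ℝ up to isomorphism; equality
-- and order are decidable, as in classical mathematics.
record Reals c ℓ : Set (suc (c ⊔ ℓ)) where
  field
    orderedField : OrderedField c ℓ

  open OrderedField orderedField public

  field
    archimedean : ∀ x → ∃ λ n → x ≤ fromℕ n
    complete    : ∀ s → Cauchy s → ∃ λ l → s ⟶ l

module Scheduling {c ℓ : Level} (ℛ : Reals c ℓ) where

  open Reals ℛ

  when : ∀ {p} {P : Set p} → Dec P → (P → ℝ) → ℝ
  when (yes p) f = f p
  when (no  _) f = 0ℝ

  sumOver : ∀ {m} (S : Subset m) → (∀ i → i ∈ S → ℝ) → ℝ
  sumOver S f = sum λ i → when (i ∈? S) (f i)

  -- The machine set is Fin m.  Processing times exist on feasible machines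
  -- only.  Irrelevance ensures that an algorithm sees numbers and the feasible
  -- set, and not, for instance, which machine witnesses nonemptiness.
  record Job (m : ℕ) : Set (c ⊔ ℓ) where
    field
      weight    : ℝ
      feasible  : Subset m
      time      : ∀ i → .(i ∈ feasible) → ℝ
      .weight≥0 : 0ℝ ≤ weight
      .nonempty : Nonempty feasible
      .time≥0   : ∀ i (i∈S : i ∈ feasible) → 0ℝ ≤ time i i∈S

  open Job public

  record Assignment {m} (J : Job m) : Set (c ⊔ ℓ) where
    field
      frac     : Fin m → ℝ
      frac≥0   : ∀ i → 0ℝ ≤ frac i
      frac≤1   : ∀ i → frac i ≤ 1ℝ
      total    : sumOver (feasible J) (λ i _ → frac i) ≡ 1ℝ
      supports : ∀ i → i ∉ feasible J → frac i ≡ 0ℝ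

  open Assignment public

  Integral : ∀ {m} {J : Job m} → Assignment J → Set c
  Integral a = ∀ i → frac a i ≡ 0ℝ ⊎ frac a i ≡ 1ℝ

  -- The arguments are the machines, the earlier jobs in order of arrival and
  -- the job that has just arrived.  The algorithm's own earlier decisions are
  -- determined by these data, so they are not passed separately.
  OnlineAlgorithm : Set (c ⊔ ℓ)
  OnlineAlgorithm = ∀ m (past : List (Job m)) (J : Job m) → Assignment J

  -- An instance on m machines lists the jobs in order of arrival.
  module _ {m} (jobs : List (Job m)) where

    JobIndex : Set
    JobIndex = Fin (length jobs)

    S : JobIndex → Subset m
    S j = feasible (lookup jobs j)

    w : JobIndex → ℝ
    w j = weight (lookup jobs j)

    p : ∀ i j → .(i ∈ S j) → ℝ
    p i j = time (lookup jobs j) i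

    Solution : Set (c ⊔ ℓ)
    Solution = ∀ j → Assignment (lookup jobs j)

    run : OnlineAlgorithm → Solution
    run A j = A m (take (toℕ j) jobs) (lookup jobs j)

    FeasibleJob : Fin m → Set
    FeasibleJob i = ∃ λ j → i ∈ S j

    -- A job of weight 0 has Smith ratio ∞ (written ⊤⁺).  This includes the
    -- indeterminate 0/0, whose position never influences the cost.
    δ : ∀ i j → .(i ∈ S j) → ℝ ⁺
    δ i j i∈S with w j ≟ 0ℝ
    ... | yes _ = ⊤⁺
    ... | no  _ = [ p i j i∈S * w j ⁻¹ ]

    open Supremum _≤_ using (_≤⁺_)

    record SmithOrder (i : Fin m) : Set (suc (c ⊔ ℓ)) where
      field
        _≺_                : Rel (FeasibleJob i) (c ⊔ ℓ)
        isStrictTotalOrder : IsStrictTotalOrder (_≡_ on proj₁) _≺_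
        δ-mono             : ∀ {k j} → k ≺ j → δ i (proj₁ k) (proj₂ k) ≤⁺ δ i (proj₁ j) (proj₂ j)

      open IsStrictTotalOrder isStrictTotalOrder public using () renaming (_<?_ to _≺?_)

    SmithOrders : Set (suc (c ⊔ ℓ))
    SmithOrders = ∀ i → SmithOrder i

    module _ (order : SmithOrders) (x : Solution) where

      private module Order i = SmithOrder (order i)

      C : JobIndex → ℝ
      C j = sumOver (S j) λ i i∈Sⱼ → frac (x j) i * (p i j i∈Sⱼ +
        sum λ k → when (i ∈? S k) λ i∈Sₖ →
          when (Order._≺?_ i (k , i∈Sₖ) (j , i∈Sⱼ)) λ _ → p i k i∈Sₖ * frac (x k) i)

      cost : ℝ
      cost = sum λ j → w j * C j

    IsOPT : SmithOrders → ℝ → Set (c ⊔ ℓ)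
    IsOPT order v =
      (∃ λ (y : Solution) → (∀ j → Integral (y j)) × (cost order y ≡ v)) ×
      (∀ (y : Solution) → (∀ j → Integral (y j)) → v ≤ cost order y)

    -- Smith orders always exist, for instance with ties broken by arrival.
    smithOrders : SmithOrders
    smithOrders i = record
      { _≺_                = λ k j → key k ⊏ key j
      ; isStrictTotalOrder = record
        { isStrictPartialOrder = record
          { isEquivalence = On.isEquivalence proj₁ ≡.isEquivalence
          ; irrefl        = λ { {_ , _} {_ , _} refl → ⊏.irrefl (refl , refl) }
          ; trans         = ⊏.trans
          ; <-resp-≈      = (λ { {_} {_ , _} {_ , _} refl k⊏j → k⊏j })
                          , (λ { {_} {_ , _} {_ , _} refl k⊏j → k⊏j })
          }
        ; compare = compare
        }
      ; δ-mono             = λ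
        { (inj₁ δₖ<δⱼ)       → proj₁ δₖ<δⱼ
        ; (inj₂ (δₖ≡δⱼ , _)) → ≤⁺.reflexive δₖ≡δⱼ
        }
      }
      where
      ≤⁺-isDecTotalOrder = Supremum.≤⁺-isDecTotalOrder-≡ _≤_ isDecTotalOrder
      module ≤⁺ = IsDecTotalOrder ≤⁺-isDecTotalOrder

      key : FeasibleJob i → ℝ ⁺ × JobIndex
      key (k , i∈S) = δ i k i∈S , k

      _⊏_ : Rel (ℝ ⁺ × JobIndex) (c ⊔ ℓ)
      _⊏_ = Lex.×-Lex _≡_ (ToStrict._<_ _≡_ _≤⁺_) Fin._<_

      module ⊏ = IsStrictTotalOrder (Lex.×-isStrictTotalOrder
        (ToStrict.<-isStrictTotalOrder₂ _≡_ _≤⁺_ ≤⁺-isDecTotalOrder)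
        (Fin.<-isStrictTotalOrder {length jobs}))

      compare : Trichotomous (_≡_ on proj₁) (λ k j → key k ⊏ key j)
      compare k@(_ , _) j@(_ , _) with ⊏.compare (key k) (key j)
      ... | tri< k⊏j k≉j k⊐j = tri< k⊏j (λ { refl → k≉j (refl , refl) }) k⊐j
      ... | tri≈ k⊏j k≈j k⊐j = tri≈ k⊏j (proj₂ k≈j) k⊐j
      ... | tri> k⊏j k≉j k⊐j = tri> k⊏j (λ { refl → k≉j (refl , refl) }) k⊐j

-- All jobs have pᵢⱼ = wⱼ, so every Smith ratio is 1 and twice the cost is
-- Σᵢ Lᵢ² (Lᵢ the load of machine i) plus an own-processing term.  Start with m
-- active machines.  In phase r = m, …, 1 there are r of them, and n jobs of
-- size b r = C(2r,r)/4ʳ arrive that are feasible exactly on these; then the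
-- least loaded one is deactivated.  The optimum puts a phase on the machine
-- deactivated at its end, hence Σ Lᵢ² = n² Σ (b r)².  For the algorithm, the
-- bound x² ≥ 2λx - λ² with λ = 2 n b (r-1) makes the final Σ Lᵢ² linear in the
-- loads, and since 2r b r = b 0 + … + b (r-1) the phases telescope to
-- Σ Lᵢ² ≥ 4 n² Σ (b r)² - O(n²).  The sum Σ (b r)² diverges, and the
-- own-processing term n Σ (b r)² of the optimum is negligible for large n.

module Submission where

open import Algebra.Bundles using (CommutativeRing)
open import Algebra.Definitions.RawMonoid using () renaming (_×′_ to times)
import Algebra.Properties.Monoid.Mult as MonoidMult
import Algebra.Properties.Ring as RingProperties
import Algebra.Properties.Semiring.Mult as SemiringMult
import Algebra.Properties.Semiring.Sum as SemiringSum
import Algebra.Solver.Ring.NaturalCoefficients.Default as Solver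
open import Data.Fin.Base using (Fin; zero; suc; toℕ)
import Data.Fin.Properties as Fin
open import Data.Fin.Subset using (Subset; _∈_; _∉_; Nonempty; ⁅_⁆; inside; outside; ⊤)
open import Data.Fin.Subset.Properties using (_∈?_; nonempty?; x∈p∧x≢y⇒x∈p-y; p─q⊆p; ∈⊤)
open import Data.List.Base
  using (List; []; _∷_; [_]; _++_; map; concat; length; lookup; take; replicate; filter; allFin; cartesianProductWith)
import Data.List.Extrema as Extrema
open import Data.List.Membership.Propositional using (lose)
open import Data.List.Membership.Propositional.Properties using (∈-allFin; ∈-filter⁺)
open import Data.List.Relation.Unary.All as All using (All; []; _∷_)
open import Data.List.Relation.Unary.All.Properties using (++⁺; replicate⁺; all-filter)
open import Data.List.Relation.Unary.Any as Any using (Any; here)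
open import Data.List.Relation.Unary.Any.Properties using (concat⁺; map⁺; cartesianProductWith⁺)
open import Data.Nat.Base as ℕ using (ℕ; zero; suc)
open import Data.Product.Base using (∃; _×_; _,_; proj₁; proj₂)
open import Data.Sum.Base using (_⊎_; inj₁; inj₂)
open import Data.Vec.Base using (_∷_; there)
open import Function.Base using (_∘_)
open import Level using (Level; _⊔_)
open import Relation.Binary.Bundles using (Poset; TotalOrder)
open import Relation.Binary.Definitions using (tri<; tri≈; tri>)
open import Relation.Binary.PropositionalEquality
  using (_≡_; _≢_; refl; sym; trans; cong; cong₂; subst; module ≡-Reasoning)
import Relation.Binary.Reasoning.PartialOrder as PosetReasoning
open import Relation.Binary.Structures using (IsDecTotalOrder; IsStrictTotalOrder)
open import Relation.Nullary.Decidable.Core using (Dec; yes; no; recompute)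
open import Relation.Nullary.Negation using (¬_; contradiction)
open import Defs

-- Heuristically, let an algorithm split every phase evenly, with job sizes `s^(-1/2)` in place of
-- `b s`. The machine deactivated in phase r has then accumulated about n times the sum of
-- `s^(-3/2)` over s ≥ r, that is `2 n r^(-1/2)`: twice what the optimum puts on it, hence the
-- factor 4 after squaring. This expected final load is also the origin of the tangent point λ. The
-- exponent 1/2 is critical: the squares sum like a harmonic series, all scales of r contribute
-- equally, and boundary effects of order n² vanish in the ratio. The obstacle is that an algorithm
-- may split unevenly and react to the deactivations, so single final loads are unpredictable. A
-- linear bound needs only their weighted sum, and its weights grow as fewer machines survive;
-- deactivating the least loaded machine leaves at least the average load on machines of larger
-- weight. The sequence `b` replaces `r^(-1/2)` because its recursion makes the balance between
-- consecutive phases exact when the least load equals the average.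

module OrderedFieldProperties {c ℓ} (F : OrderedField c ℓ) where

  -- Arithmetic, order and finite sums in an ordered field

  open OrderedField F
  open CommutativeRing commutativeRing public
    using ( +-comm; +-assoc; +-identityˡ; +-identityʳ; *-comm; *-identityˡ; *-identityʳ
          ; zeroˡ; zeroʳ; distribˡ; -‿inverseʳ; -‿inverseˡ; commutativeSemiring; semiring; ring; +-rawMonoid; +-monoid)
  open RingProperties ring using (-‿distribˡ-*; -‿distribʳ-*; -‿involutive)
  open SemiringSum semiring public
    using (sum-cong-≗; sum-replicate-zero; ∑-distrib-+; ∑-comm; *-distribˡ-sum; *-distribʳ-sum)
  open Solver commutativeSemiring public
    using (solve; _:=_; _:+_; _:*_; con)

  poset : Poset c c ℓ
  poset = record { isPartialOrder = IsDecTotalOrder.isPartialOrder isDecTotalOrder }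

  open Poset poset public using () renaming (refl to ≤-refl; trans to ≤-trans; antisym to ≤-antisym; reflexive to ≤-reflexive)
  open IsDecTotalOrder isDecTotalOrder public using () renaming (total to ≤-total)
  module ≤-Reasoning = PosetReasoning poset
  open ≤-Reasoning

  -- The normal form to which the solver evaluates `con n`. It differs from `fromℕ n`, which ends in
  -- `+ 0ℝ`; where the two meet, `fromℕ 4` or `fromℕ 5` is spelled out inside the polynomial.
  lit : ℕ → ℝ
  lit n = times +-rawMonoid n 1ℝ

  private variable x y z u v : ℝ

  +-monoˡ-≤ : ∀ z → x ≤ y → x + z ≤ y + z
  +-monoˡ-≤ {x} {y} z x≤y = begin
    x + z ≡⟨ +-comm x z ⟩
    z + x ≤⟨ +-monoʳ-≤ z x≤y ⟩
    z + y ≡⟨ +-comm z y ⟩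
    y + z ∎

  +-mono-≤ : x ≤ y → u ≤ v → x + u ≤ y + v
  +-mono-≤ {x} {y} {u} {v} x≤y u≤v = ≤-trans (+-monoˡ-≤ u x≤y) (+-monoʳ-≤ y u≤v)

  +-nonneg : 0ℝ ≤ x → 0ℝ ≤ y → 0ℝ ≤ x + y
  +-nonneg {x} {y} 0≤x 0≤y = subst (_≤ x + y) (+-identityˡ 0ℝ) (+-mono-≤ 0≤x 0≤y)

  x≤x+y : ∀ x → 0ℝ ≤ y → x ≤ x + y
  x≤x+y {y} x 0≤y = subst (_≤ x + y) (+-identityʳ x) (+-monoʳ-≤ x 0≤y)

  +-cancelˡ-≤ : ∀ z → z + x ≤ z + y → x ≤ y
  +-cancelˡ-≤ {x} {y} z z+x≤z+y = begin
    x                ≡⟨ cancel x ⟨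
    - z + (z + x)    ≤⟨ +-monoʳ-≤ (- z) z+x≤z+y ⟩
    - z + (z + y)    ≡⟨ cancel y ⟩
    y                ∎
    where
    cancel : ∀ t → - z + (z + t) ≡ t
    cancel t = trans (sym (+-assoc (- z) z t)) (trans (cong (_+ t) (-‿inverseˡ z)) (+-identityˡ t))

  -- Trades an inequality for an equation with a nonnegative slack, so that polynomial inequalities
  -- reduce to semiring identities without subtraction.
  difference : x ≤ y → ∃ λ d → 0ℝ ≤ d × y ≡ x + d
  difference {x} {y} x≤y = y - x , +-cancelˡ-≤ x (begin
    x + 0ℝ       ≡⟨ +-identityʳ x ⟩
    x            ≤⟨ x≤y ⟩
    y            ≡⟨ y≡x+d ⟩
    x + (y - x)  ∎) , y≡x+d
    where
    y≡x+d : y ≡ x + (y - x)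
    y≡x+d = sym (trans (cong (x +_) (+-comm y (- x)))
      (trans (sym (+-assoc x (- x) y)) (trans (cong (_+ y) (-‿inverseʳ x)) (+-identityˡ y))))

  *-monoʳ-≤ : 0ℝ ≤ z → x ≤ y → z * x ≤ z * y
  *-monoʳ-≤ {z} {x} {y} 0≤z x≤y with difference x≤y
  ... | d , 0≤d , refl = subst (z * x ≤_) (sym (distribˡ z x d)) (x≤x+y (z * x) (*-nonneg 0≤z 0≤d))

  *-monoˡ-≤ : 0ℝ ≤ z → x ≤ y → x * z ≤ y * z
  *-monoˡ-≤ {z} {x} {y} 0≤z x≤y = begin
    x * z  ≡⟨ *-comm x z ⟩
    z * x  ≤⟨ *-monoʳ-≤ 0≤z x≤y ⟩
    z * y  ≡⟨ *-comm z y ⟩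
    y * z  ∎

  neg-nonneg : x ≤ 0ℝ → 0ℝ ≤ - x
  neg-nonneg {x} x≤0 = +-cancelˡ-≤ x (begin
    x + 0ℝ   ≡⟨ +-identityʳ x ⟩
    x        ≤⟨ x≤0 ⟩
    0ℝ       ≡⟨ -‿inverseʳ x ⟨
    x + - x  ∎)

  square-nonneg : ∀ x → 0ℝ ≤ x * x
  square-nonneg x with ≤-total 0ℝ x
  ... | inj₁ 0≤x = *-nonneg 0≤x 0≤x
  ... | inj₂ x≤0 = subst (0ℝ ≤_) -x*-x≡x*x (*-nonneg (neg-nonneg x≤0) (neg-nonneg x≤0))
    where
    -x*-x≡x*x : - x * - x ≡ x * x
    -x*-x≡x*x = trans (sym (-‿distribˡ-* x (- x)))
      (trans (cong -_ (sym (-‿distribʳ-* x x))) (-‿involutive (x * x)))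

  0≤1 : 0ℝ ≤ 1ℝ
  0≤1 = subst (0ℝ ≤_) (*-identityˡ 1ℝ) (square-nonneg 1ℝ)

  fromℕ-nonneg : ∀ n → 0ℝ ≤ fromℕ n
  fromℕ-nonneg zero    = ≤-refl
  fromℕ-nonneg (suc n) = +-nonneg 0≤1 (fromℕ-nonneg n)

  1≤fromℕ-suc : ∀ n → 1ℝ ≤ fromℕ (suc n)
  1≤fromℕ-suc n = x≤x+y 1ℝ (fromℕ-nonneg n)

  1≤⇒≢0 : 1ℝ ≤ x → x ≢ 0ℝ
  1≤⇒≢0 1≤0 refl = 0≢1 (≤-antisym 0≤1 1≤0)

  ⁻¹-nonneg : 0ℝ ≤ x → x ≢ 0ℝ → 0ℝ ≤ x ⁻¹
  ⁻¹-nonneg {x} 0≤x x≢0 with ≤-total 0ℝ (x ⁻¹)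
  ... | inj₁ 0≤x⁻¹ = 0≤x⁻¹
  ... | inj₂ x⁻¹≤0 = contradiction (≤-antisym 0≤1 1≤0) 0≢1
    where
    1≤0 : 1ℝ ≤ 0ℝ
    1≤0 = begin
      1ℝ        ≡⟨ *-inverseʳ x x≢0 ⟨
      x * x ⁻¹  ≤⟨ *-monoʳ-≤ 0≤x x⁻¹≤0 ⟩
      x * 0ℝ    ≡⟨ zeroʳ x ⟩
      0ℝ        ∎

  -- With `1ℝ ≤ z` in place of positivity no inverse is involved: if x = y + d with d ≥ 0, then d ≤
  -- z d ≤ 0.
  *-cancelˡ-≤ : 1ℝ ≤ z → z * x ≤ z * y → x ≤ y
  *-cancelˡ-≤ {z} {x} {y} 1≤z zx≤zy with ≤-total x y
  ... | inj₁ x≤y = x≤y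
  ... | inj₂ y≤x with difference y≤x
  ...   | d , 0≤d , refl = begin
    y + d   ≤⟨ +-monoʳ-≤ y (begin
      d       ≡⟨ *-identityˡ d ⟨
      1ℝ * d  ≤⟨ *-monoˡ-≤ 0≤d 1≤z ⟩
      z * d   ≤⟨ +-cancelˡ-≤ (z * y) (begin
        z * y + z * d  ≡⟨ distribˡ z y d ⟨
        z * (y + d)    ≤⟨ zx≤zy ⟩
        z * y          ≡⟨ +-identityʳ (z * y) ⟨
        z * y + 0ℝ     ∎) ⟩
      0ℝ      ∎) ⟩
    y + 0ℝ  ≡⟨ +-identityʳ y ⟩
    y       ∎

  +-cancelˡ : ∀ z → z + x ≡ z + y → x ≡ y
  +-cancelˡ z eq = ≤-antisym (+-cancelˡ-≤ z (≤-reflexive eq)) (+-cancelˡ-≤ z (≤-reflexive (sym eq)))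

  halve : x + x ≤ y + y → x ≤ y
  halve {x} {y} 2x≤2y = *-cancelˡ-≤ (x≤x+y 1ℝ 0≤1) (begin
    lit 2 * x  ≡⟨ solve 1 (λ x → con 2 :* x := x :+ x) refl x ⟩
    x + x      ≤⟨ 2x≤2y ⟩
    y + y      ≡⟨ solve 1 (λ y → con 2 :* y := y :+ y) refl y ⟨
    lit 2 * y  ∎)

  lit-nonneg : ∀ n → 0ℝ ≤ lit n
  lit-nonneg zero          = ≤-refl
  lit-nonneg (suc zero)    = 0≤1
  lit-nonneg (suc (suc n)) = +-nonneg (lit-nonneg (suc n)) 0≤1

  2xy≤x²+y² : ∀ x y → lit 2 * (x * y) ≤ x * x + y * y
  2xy≤x²+y² x y with ≤-total x y
  ... | inj₁ x≤y with difference x≤y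
  ...   | d , _ , refl = begin
    lit 2 * (x * (x + d))            ≤⟨ x≤x+y _ (square-nonneg d) ⟩
    lit 2 * (x * (x + d)) + d * d    ≡⟨ solve 2 (λ x d → con 2 :* (x :* (x :+ d)) :+ d :* d := x :* x :+ (x :+ d) :* (x :+ d)) refl x d ⟩
    x * x + (x + d) * (x + d)        ∎
  2xy≤x²+y² x y | inj₂ y≤x with difference y≤x
  ...   | d , _ , refl = begin
    lit 2 * ((y + d) * y)            ≤⟨ x≤x+y _ (square-nonneg d) ⟩
    lit 2 * ((y + d) * y) + d * d    ≡⟨ solve 2 (λ x d → con 2 :* ((x :+ d) :* x) :+ d :* d := (x :+ d) :* (x :+ d) :+ x :* x) refl y d ⟩
    (y + d) * (y + d) + y * y        ∎

  sum-mono-≤ : ∀ {n} {f g : Fin n → ℝ} → (∀ i → f i ≤ g i) → sum f ≤ sum g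
  sum-mono-≤ {zero}  f≤g = ≤-refl
  sum-mono-≤ {suc n} f≤g = +-mono-≤ (f≤g zero) (sum-mono-≤ (λ i → f≤g (suc i)))

  sum-zero : ∀ {n} {f : Fin n → ℝ} → (∀ i → f i ≡ 0ℝ) → sum f ≡ 0ℝ
  sum-zero {n} f≡0 = trans (sum-cong-≗ f≡0) (sum-replicate-zero n)

  sum-nonneg : ∀ {n} {f : Fin n → ℝ} → (∀ i → 0ℝ ≤ f i) → 0ℝ ≤ sum f
  sum-nonneg {n} {f} 0≤f = subst (_≤ sum f) (sum-replicate-zero n) (sum-mono-≤ 0≤f)

  sum-square : ∀ {n} (f : Fin n → ℝ) → sum f * sum f ≡ sum λ i → sum λ j → f i * f j
  sum-square f = trans (*-distribʳ-sum (sum f) f) (sum-cong-≗ λ i → *-distribˡ-sum (f i) f)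

  open SemiringMult semiring using () renaming (×1-homo-* to fromℕ-*) public
  open MonoidMult +-monoid using (×-homo-+)

  fromℕ-+ : ∀ m n → fromℕ (m ℕ.+ n) ≡ fromℕ m + fromℕ n
  fromℕ-+ = ×-homo-+ 1ℝ

-- The scaled central binomial coefficients and the divergence of the sum of their squares

module CentralBinomial {c ℓ} (F : OrderedField c ℓ) where

  open OrderedField F
  open OrderedFieldProperties F
  open ≤-Reasoning

  denominator : ℕ → ℝ
  denominator k = lit 2 * fromℕ (suc k)

  1≤denominator : ∀ k → 1ℝ ≤ denominator k
  1≤denominator k = begin
    1ℝ                             ≤⟨ x≤x+y 1ℝ (+-nonneg 0≤1 (+-nonneg (fromℕ-nonneg k) (fromℕ-nonneg k))) ⟩
    1ℝ + (1ℝ + (fromℕ k + fromℕ k)) ≡⟨ solve 1 (λ k → con 1 :+ (con 1 :+ (k :+ k)) := con 2 :* (con 1 :+ k)) refl (fromℕ k) ⟩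
    lit 2 * fromℕ (suc k)          ∎

  -- b k is the central binomial coefficient (2k choose k) divided by 4ᵏ, and
  -- e k = b k - b (k+1).
  b e : ℕ → ℝ
  b zero    = 1ℝ
  b (suc k) = e k * (1ℝ + lit 2 * fromℕ k)
  e k = b k * denominator k ⁻¹

  b≡e*denominator : ∀ k → b k ≡ e k * denominator k
  b≡e*denominator k = begin-equality
    b k                                         ≡⟨ *-identityʳ (b k) ⟨
    b k * 1ℝ                                    ≡⟨ cong (b k *_) (*-inverseʳ (denominator k) (1≤⇒≢0 (1≤denominator k))) ⟨
    b k * (denominator k * denominator k ⁻¹)   ≡⟨ solve 3 (λ x y z → x :* (y :* z) := x :* z :* y) refl (b k) (denominator k) (denominator k ⁻¹) ⟩
    e k * denominator k                         ∎

  b≡b+e : ∀ k → b k ≡ b (suc k) + e k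
  b≡b+e k = trans (b≡e*denominator k)
    (solve 2 (λ e k → e :* (con 2 :* (con 1 :+ k)) := e :* (con 1 :+ con 2 :* k) :+ e) refl (e k) (fromℕ k))

  b-nonneg : ∀ k → 0ℝ ≤ b k
  e-nonneg : ∀ k → 0ℝ ≤ e k
  b-nonneg zero    = 0≤1
  b-nonneg (suc k) = *-nonneg (e-nonneg k) (+-nonneg 0≤1 (*-nonneg (lit-nonneg 2) (fromℕ-nonneg k)))
  e-nonneg k = *-nonneg (b-nonneg k)
    (⁻¹-nonneg (≤-trans 0≤1 (1≤denominator k)) (1≤⇒≢0 (1≤denominator k)))

  squares : ℕ → ℝ
  squares zero    = 0ℝ
  squares (suc k) = squares k + b (suc k) * b (suc k)

  -- `squares` collects the job sizes `b 1`, ..., `b r`, while this sum collects the tangent points,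
  -- whose index is lower by one. The shift costs at most `b 0` squared, which is 1.
  squares₀ : ℕ → ℝ
  squares₀ zero    = 0ℝ
  squares₀ (suc k) = squares₀ k + b k * b k

  squares₀≤1+squares : ∀ k → squares₀ k ≤ 1ℝ + squares k
  squares₀≤1+squares k = subst (squares₀ k ≤_) (shift k) (x≤x+y (squares₀ k) (square-nonneg (b k)))
    where
    shift : ∀ k → squares₀ k + b k * b k ≡ 1ℝ + squares k
    shift zero    = solve 0 (con 0 :+ con 1 :* con 1 := con 1 :+ con 0) refl
    shift (suc k) = trans (cong (_+ b (suc k) * b (suc k)) (shift k)) (+-assoc 1ℝ (squares k) _)

  -- The product (4k+1) b(k)² starts at 1 and never decreases: its increment from k to k+1 is
  -- exactly the square of `e k`, because (4k+5)(2k+1)² = (4k+1)(2k+2)² + 1. Hence b(k)² ≥ 1/(4k+1),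
  -- a comparison with the harmonic series.
  1≤[4k+1]b² : ∀ k → 1ℝ ≤ (1ℝ + lit 4 * fromℕ k) * (b k * b k)
  1≤[4k+1]b² zero    = ≤-reflexive (solve 0 (con 1 := (con 1 :+ con 4 :* con 0) :* (con 1 :* con 1)) refl)
  1≤[4k+1]b² (suc k) = begin
    1ℝ                                                                ≤⟨ 1≤[4k+1]b² k ⟩
    (1ℝ + lit 4 * fromℕ k) * (b k * b k)                              ≡⟨ cong (λ t → (1ℝ + lit 4 * fromℕ k) * (t * t)) (b≡e*denominator k) ⟩
    (1ℝ + lit 4 * fromℕ k) * ((e k * denominator k) * (e k * denominator k))  ≤⟨ x≤x+y _ (square-nonneg (e k)) ⟩
    (1ℝ + lit 4 * fromℕ k) * ((e k * denominator k) * (e k * denominator k)) + e k * e k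
      ≡⟨ solve 2 (λ e k → (con 1 :+ con 4 :* k) :* ((e :* (con 2 :* (con 1 :+ k))) :* (e :* (con 2 :* (con 1 :+ k)))) :+ e :* e
                   := (con 1 :+ con 4 :* (con 1 :+ k)) :* ((e :* (con 1 :+ con 2 :* k)) :* (e :* (con 1 :+ con 2 :* k)))) refl (e k) (fromℕ k) ⟩
    (1ℝ + lit 4 * fromℕ (suc k)) * (b (suc k) * b (suc k))            ∎

  -- Each added square is at least 1/a as long as its index k satisfies 4k + 1 ≤ a. Multiplying by a
  -- keeps the induction free of inverses.
  squares-growth : ∀ {a} m j → 1ℝ + lit 4 * fromℕ (j ℕ.+ m) ≤ a →
                   a * squares m + fromℕ j ≤ a * squares (j ℕ.+ m)
  squares-growth m zero    _ = ≤-reflexive (+-identityʳ _)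
  squares-growth {a} m (suc j) 4k+5≤a = begin
    a * squares m + (1ℝ + fromℕ j)        ≡⟨ solve 2 (λ x j → x :+ (con 1 :+ j) := x :+ j :+ con 1) refl (a * squares m) (fromℕ j) ⟩
    a * squares m + fromℕ j + 1ℝ          ≤⟨ +-mono-≤ (squares-growth m j (≤-trans 4k+1≤4k+5 4k+5≤a)) (begin
      1ℝ                                             ≤⟨ 1≤[4k+1]b² (suc k) ⟩
      (1ℝ + lit 4 * fromℕ (suc k)) * (b (suc k) * b (suc k))  ≤⟨ *-monoˡ-≤ (square-nonneg (b (suc k))) 4k+5≤a ⟩
      a * (b (suc k) * b (suc k))                    ∎) ⟩
    a * squares k + a * (b (suc k) * b (suc k))      ≡⟨ distribˡ a (squares k) _ ⟨
    a * squares (suc k)                   ∎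
    where
    k : ℕ
    k = j ℕ.+ m

    4k+1≤4k+5 : 1ℝ + lit 4 * fromℕ k ≤ 1ℝ + lit 4 * fromℕ (suc k)
    4k+1≤4k+5 = begin
      1ℝ + lit 4 * fromℕ k              ≤⟨ x≤x+y _ (lit-nonneg 4) ⟩
      1ℝ + lit 4 * fromℕ k + lit 4      ≡⟨ solve 1 (λ k → con 1 :+ con 4 :* k :+ con 4 := con 1 :+ con 4 :* (con 1 :+ k)) refl (fromℕ k) ⟩
      1ℝ + lit 4 * fromℕ (suc k)        ∎

  -- A block of j = 4m + 1 terms after m ends at index 5m + 1, where 4k + 1 = 20m + 5 = 5j. Each of
  -- its j squares is thus at least 1/(5j), and the block contributes at least 1/5 whatever m is.
  squares-grow-by-⅕ : ∀ m → lit 5 * squares m + 1ℝ ≤ lit 5 * squares (suc (4 ℕ.* m) ℕ.+ m)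
  squares-grow-by-⅕ m = *-cancelˡ-≤ 1≤g (begin
    g * (lit 5 * squares m + 1ℝ)         ≡⟨ solve 2 (λ g s → g :* (con 5 :* s :+ con 1) := con 5 :* g :* s :+ g) refl g (squares m) ⟩
    lit 5 * g * squares m + g            ≡⟨ cong (lit 5 * g * squares m +_) (sym fromℕ-j) ⟩
    lit 5 * g * squares m + fromℕ j      ≤⟨ squares-growth m j (≤-reflexive 4k+1≡5g) ⟩
    lit 5 * g * squares (j ℕ.+ m)        ≡⟨ solve 2 (λ g s → con 5 :* g :* s := g :* (con 5 :* s)) refl g (squares (j ℕ.+ m)) ⟩
    g * (lit 5 * squares (j ℕ.+ m))      ∎)
    where
    j : ℕ
    j = suc (4 ℕ.* m)

    g : ℝ
    g = 1ℝ + fromℕ 4 * fromℕ m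

    1≤g : 1ℝ ≤ g
    1≤g = x≤x+y 1ℝ (*-nonneg (fromℕ-nonneg 4) (fromℕ-nonneg m))

    fromℕ-j : fromℕ j ≡ g
    fromℕ-j = cong (1ℝ +_) (fromℕ-* 4 m)

    4k+1≡5g : 1ℝ + lit 4 * fromℕ (j ℕ.+ m) ≡ lit 5 * g
    4k+1≡5g = trans
      (cong (λ t → 1ℝ + lit 4 * t) (trans (fromℕ-+ j m) (cong (_+ fromℕ m) fromℕ-j)))
      (solve 1 (λ m → let four = con 1 :+ (con 1 :+ (con 1 :+ (con 1 :+ con 0))) in
                 con 1 :+ con 4 :* (con 1 :+ four :* m :+ m) := con 5 :* (con 1 :+ four :* m)) refl (fromℕ m))

  squares-unbounded : ∀ n → ∃ λ m → fromℕ n ≤ squares m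
  squares-unbounded n with 5squares-unbounded (5 ℕ.* n)
    where
    5squares-unbounded : ∀ n → ∃ λ m → fromℕ n ≤ lit 5 * squares m
    5squares-unbounded zero    = zero , ≤-reflexive (sym (zeroʳ (lit 5)))
    5squares-unbounded (suc n) with 5squares-unbounded n
    ... | m , n≤5squares = suc (4 ℕ.* m) ℕ.+ m , (begin
      1ℝ + fromℕ n               ≡⟨ +-comm 1ℝ (fromℕ n) ⟩
      fromℕ n + 1ℝ               ≤⟨ +-monoˡ-≤ 1ℝ n≤5squares ⟩
      lit 5 * squares m + 1ℝ     ≤⟨ squares-grow-by-⅕ m ⟩
      lit 5 * squares (suc (4 ℕ.* m) ℕ.+ m) ∎)
  ... | m , 5n≤5squares = m , *-cancelˡ-≤ (1≤fromℕ-suc 4) (begin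
    fromℕ 5 * fromℕ n     ≡⟨ fromℕ-* 5 n ⟨
    fromℕ (5 ℕ.* n)       ≤⟨ 5n≤5squares ⟩
    lit 5 * squares m     ≡⟨ solve 1 (λ s → con 5 :* s := (con 1 :+ (con 1 :+ (con 1 :+ (con 1 :+ (con 1 :+ con 0))))) :* s) refl (squares m) ⟩
    fromℕ 5 * squares m   ∎)

-- The cost of instances with unit Smith ratios in terms of machine loads

module CostIdentity {c ℓ} (ℛ : Reals c ℓ) where

  open Reals ℛ
  open Scheduling ℛ
  open OrderedFieldProperties orderedField

  when-true : ∀ {p} {P : Set p} (P? : Dec P) {f : P → ℝ} {v} → P → (∀ p → f p ≡ v) → when P? f ≡ v
  when-true (yes p) _ f≡v = f≡v p
  when-true (no ¬p) p _   = contradiction p ¬p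

  when-false : ∀ {p} {P : Set p} (P? : Dec P) {f : P → ℝ} → ¬ P → when P? f ≡ 0ℝ
  when-false (yes p) ¬p = contradiction p ¬p
  when-false (no _)  _  = refl

  when-zero : ∀ {p} {P : Set p} (P? : Dec P) → when P? (λ _ → 0ℝ) ≡ 0ℝ
  when-zero (yes _) = refl
  when-zero (no _)  = refl

  when-cong : ∀ {p} {P : Set p} (P? : Dec P) {f g : P → ℝ} → (∀ p → f p ≡ g p) → when P? f ≡ when P? g
  when-cong (yes p) f≡g = f≡g p
  when-cong (no _)  _   = refl

  *-when : ∀ {p} {P : Set p} (P? : Dec P) {f : P → ℝ} x → x * when P? f ≡ when P? λ p → x * f p
  *-when (yes _) x = refl
  *-when (no _)  x = zeroʳ x

  sum-single : ∀ {n} {f : Fin n → ℝ} i → (∀ k → k ≢ i → f k ≡ 0ℝ) → sum f ≡ f i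
  sum-single {f = f} zero    f≡0 = trans (cong (f zero +_) (sum-zero λ k → f≡0 (suc k) λ ())) (+-identityʳ (f zero))
  sum-single {f = f} (suc i) f≡0 = trans
    (cong₂ _+_ (f≡0 zero λ ()) (sum-single i λ k k≢i → f≡0 (suc k) λ { refl → k≢i refl }))
    (+-identityˡ (f (suc i)))

  UnitRatio : ∀ {m} → Job m → Set c
  UnitRatio J = ∀ i .(i∈S : i ∈ feasible J) → time J i i∈S ≡ weight J

  -- The bound stored in a job is irrelevant; decidability of the order makes it usable again.
  weight-nonneg : ∀ {m} (J : Job m) → 0ℝ ≤ weight J
  weight-nonneg record { weight = w ; weight≥0 = 0≤w } = recompute (0ℝ ≤? w) 0≤w

  module _ {m : ℕ} (jobs : List (Job m)) where

    contribution : Solution jobs → Fin m → JobIndex jobs → ℝ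
    contribution x i j = w jobs j * frac (x j) i

    load : Solution jobs → Fin m → ℝ
    load x i = sum (contribution x i)

    load-nonneg : ∀ x i → 0ℝ ≤ load x i
    load-nonneg x i = sum-nonneg λ j → *-nonneg (weight-nonneg (lookup jobs j)) (frac≥0 (x j) i)

    module _ (unitRatio : ∀ j → UnitRatio (lookup jobs j)) (order : SmithOrders jobs) (x : Solution jobs) where

      private
        a = contribution x
        module Order i = SmithOrder (order i)

      precedes? : ∀ i {k j} i∈Sₖ i∈Sⱼ → Dec (Order._≺_ i (k , i∈Sₖ) (j , i∈Sⱼ))
      precedes? i i∈Sₖ i∈Sⱼ = Order._≺?_ i (_ , i∈Sₖ) (_ , i∈Sⱼ)

      delay : Fin m → JobIndex jobs → JobIndex jobs → ℝ
      delay i j k = when (i ∈? S jobs j) λ i∈Sⱼ → when (i ∈? S jobs k) λ i∈Sₖ →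
        when (precedes? i i∈Sₖ i∈Sⱼ) λ _ → a i j * a i k

      processing : Fin m → JobIndex jobs → ℝ
      processing i j = w jobs j * w jobs j * frac (x j) i

      weighted-completion : ∀ j →
        w jobs j * C jobs order x j ≡ sum λ i → processing i j + sum (delay i j)
      weighted-completion j = trans (*-distribˡ-sum {m} (w jobs j) _) (sum-cong-≗ on-machine)
        where
        on-machine : ∀ i → w jobs j * when (i ∈? S jobs j) (λ i∈Sⱼ → frac (x j) i * (p jobs i j i∈Sⱼ +
          sum λ k → when (i ∈? S jobs k) λ i∈Sₖ →
            when (Order._≺?_ i (k , i∈Sₖ) (j , i∈Sⱼ)) λ _ → p jobs i k i∈Sₖ * frac (x k) i))
          ≡ processing i j + sum (delay i j)
        on-machine i with i ∈? S jobs j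
        ... | no i∉Sⱼ = begin
          w jobs j * 0ℝ                          ≡⟨ zeroʳ (w jobs j) ⟩
          0ℝ                                     ≡⟨ zeroʳ (w jobs j * w jobs j) ⟨
          w jobs j * w jobs j * 0ℝ               ≡⟨ cong (w jobs j * w jobs j *_) (supports (x j) i i∉Sⱼ) ⟨
          processing i j                         ≡⟨ +-identityʳ (processing i j) ⟨
          processing i j + 0ℝ                    ≡⟨ cong (processing i j +_) (sum-zero {length jobs} λ _ → refl) ⟨
          processing i j + sum {length jobs} (λ _ → 0ℝ)  ∎
          where open ≡-Reasoning
        ... | yes i∈Sⱼ = begin
          w jobs j * (frac (x j) i * (p jobs i j i∈Sⱼ + sum inner))
            ≡⟨ cong (λ t → w jobs j * (frac (x j) i * (t + sum inner))) (unitRatio j i i∈Sⱼ) ⟩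
          w jobs j * (frac (x j) i * (w jobs j + sum inner))
            ≡⟨ solve 3 (λ w x d → w :* (x :* (w :+ d)) := w :* w :* x :+ w :* x :* d) refl (w jobs j) (frac (x j) i) (sum inner) ⟩
          processing i j + a i j * sum inner
            ≡⟨ cong (processing i j +_) (trans (*-distribˡ-sum (a i j) inner) (sum-cong-≗ λ k →
                 trans (*-when (i ∈? S jobs k) (a i j)) (when-cong (i ∈? S jobs k) λ i∈Sₖ →
                 trans (*-when (precedes? i i∈Sₖ i∈Sⱼ) (a i j)) (when-cong (precedes? i i∈Sₖ i∈Sⱼ) λ _ →
                 cong (λ t → a i j * (t * frac (x k) i)) (unitRatio k i i∈Sₖ))))) ⟩
          processing i j + sum (λ k → when (i ∈? S jobs k) λ i∈Sₖ → when (precedes? i i∈Sₖ i∈Sⱼ) λ _ → a i j * a i k) ∎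
          where
          open ≡-Reasoning
          inner : JobIndex jobs → ℝ
          inner k = when (i ∈? S jobs k) λ i∈Sₖ →
            when (precedes? i i∈Sₖ i∈Sⱼ) λ _ → p jobs i k i∈Sₖ * frac (x k) i

      cost-by-machine : cost jobs order x ≡
        (sum λ i → sum (processing i)) + (sum λ i → sum λ j → sum (delay i j))
      cost-by-machine = begin
        (sum λ j → w jobs j * C jobs order x j)                         ≡⟨ sum-cong-≗ weighted-completion ⟩
        (sum λ j → sum λ i → processing i j + sum (delay i j))          ≡⟨ ∑-comm {length jobs} {m} (λ j i → processing i j + sum (delay i j)) ⟩
        (sum λ i → sum λ j → processing i j + sum (delay i j))          ≡⟨ sum-cong-≗ (λ i → ∑-distrib-+ (processing i) (λ j → sum (delay i j))) ⟩
        (sum λ i → sum (processing i) + sum λ j → sum (delay i j))      ≡⟨ ∑-distrib-+ (λ i → sum (processing i)) _ ⟩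
        (sum λ i → sum (processing i)) + (sum λ i → sum λ j → sum (delay i j)) ∎
        where open ≡-Reasoning

      diagonal : Fin m → JobIndex jobs → JobIndex jobs → ℝ
      diagonal i j k = when (j Fin.≟ k) λ _ → a i j * a i j

      contribution-infeasible : ∀ i j → i ∉ S jobs j → a i j ≡ 0ℝ
      contribution-infeasible i j i∉Sⱼ = trans (cong (w jobs j *_) (supports (x j) i i∉Sⱼ)) (zeroʳ (w jobs j))

      -- Any strict total order contains exactly one of (j , k), (k , j) off the
      -- diagonal, so the way ties are broken is irrelevant.
      delay-symmetrised : ∀ i j k → delay i j k + delay i k j + diagonal i j k ≡ a i j * a i k
      delay-symmetrised i j k = go (i ∈? S jobs j) (i ∈? S jobs k)
        where
        open ≡-Reasoning
        -- `off` and `off′` are the two opposite delays with the feasibility decisions as arguments,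
        -- so that matching on these in `go` reduces both at once.
        off : Dec (i ∈ S jobs j) → Dec (i ∈ S jobs k) → ℝ
        off j? k? = when j? λ i∈Sⱼ → when k? λ i∈Sₖ → when (precedes? i i∈Sₖ i∈Sⱼ) λ _ → a i j * a i k
        off′ : Dec (i ∈ S jobs j) → Dec (i ∈ S jobs k) → ℝ
        off′ j? k? = when k? λ i∈Sₖ → when j? λ i∈Sⱼ → when (precedes? i i∈Sⱼ i∈Sₖ) λ _ → a i k * a i j

        zeros : ∀ {u v t} → u ≡ 0ℝ → v ≡ 0ℝ → u + v + t ≡ t
        zeros {t = t} refl refl = trans (cong (_+ t) (+-identityˡ 0ℝ)) (+-identityˡ t)

        diagonal-zero : a i j ≡ 0ℝ → diagonal i j k ≡ 0ℝ
        diagonal-zero a≡0 with j Fin.≟ k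
        ... | yes _ = trans (cong (_* a i j) a≡0) (zeroˡ (a i j))
        ... | no _  = refl

        go : ∀ j? k? → off j? k? + off′ j? k? + diagonal i j k ≡ a i j * a i k
        go (no i∉Sⱼ) k? = begin
          0ℝ + off′ (no i∉Sⱼ) k? + diagonal i j k  ≡⟨ zeros refl (off′≡0 k?) ⟩
          diagonal i j k                           ≡⟨ diagonal-zero (contribution-infeasible i j i∉Sⱼ) ⟩
          0ℝ                                       ≡⟨ zeroˡ (a i k) ⟨
          0ℝ * a i k                               ≡⟨ cong (_* a i k) (contribution-infeasible i j i∉Sⱼ) ⟨
          a i j * a i k                            ∎
          where
          off′≡0 : ∀ k? → off′ (no i∉Sⱼ) k? ≡ 0ℝ
          off′≡0 (yes _) = refl
          off′≡0 (no _)  = refl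
        go (yes i∈Sⱼ) (no i∉Sₖ) = begin
          0ℝ + 0ℝ + diagonal i j k  ≡⟨ zeros refl refl ⟩
          diagonal i j k            ≡⟨ when-false (j Fin.≟ k) (λ { refl → i∉Sₖ i∈Sⱼ }) ⟩
          0ℝ                        ≡⟨ zeroʳ (a i j) ⟨
          a i j * 0ℝ                ≡⟨ cong (a i j *_) (contribution-infeasible i k i∉Sₖ) ⟨
          a i j * a i k             ∎
        -- Whether j precedes k is decided by this very comparison, so `off′` has already reduced in
        -- each branch (the `refl` below); only the decision for k before j has to be rewritten.
        go (yes i∈Sⱼ) (yes i∈Sₖ) with IsStrictTotalOrder.compare (Order.isStrictTotalOrder i) (j , i∈Sⱼ) (k , i∈Sₖ)
        ... | tri< j≺k j≢k k⊀j = begin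
          _  ≡⟨ cong₂ _+_ (cong₂ _+_ (when-false (precedes? i i∈Sₖ i∈Sⱼ) k⊀j)
                                    refl)
                          (when-false (j Fin.≟ k) j≢k) ⟩
          0ℝ + a i k * a i j + 0ℝ  ≡⟨ solve 2 (λ j k → con 0 :+ k :* j :+ con 0 := j :* k) refl (a i j) (a i k) ⟩
          a i j * a i k            ∎
        ... | tri> j⊀k j≢k k≺j = begin
          _  ≡⟨ cong₂ _+_ (cong₂ _+_ (when-true (precedes? i i∈Sₖ i∈Sⱼ) k≺j λ _ → refl)
                                    refl)
                          (when-false (j Fin.≟ k) j≢k) ⟩
          a i j * a i k + 0ℝ + 0ℝ  ≡⟨ solve 2 (λ j k → j :* k :+ con 0 :+ con 0 := j :* k) refl (a i j) (a i k) ⟩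
          a i j * a i k            ∎
        ... | tri≈ j⊀k j≡k k⊀j = begin
          _  ≡⟨ zeros (when-false (precedes? i i∈Sₖ i∈Sⱼ) k⊀j) refl ⟩
          diagonal i j k           ≡⟨ when-true (j Fin.≟ k) j≡k (λ _ → refl) ⟩
          a i j * a i j            ≡⟨ cong (λ t → a i j * a i t) j≡k ⟩
          a i j * a i k            ∎

      delay-on-machine : ∀ i → let d = sum λ j → sum (delay i j) in
        d + d + (sum λ j → a i j * a i j) ≡ load x i * load x i
      delay-on-machine i = begin
        d + d + sum diag
          ≡⟨ cong₂ _+_ (cong (d +_) (∑-comm (delay i))) (sum-cong-≗ λ j → sym (sum-diagonal j)) ⟩
        d + (sum λ j → sum λ k → delay i k j) + (sum λ j → sum (diagonal i j))
          ≡⟨ cong (_+ (sum λ j → sum (diagonal i j))) (sym (∑-distrib-+ (λ j → sum (delay i j)) _)) ⟩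
        (sum λ j → sum (delay i j) + sum λ k → delay i k j) + (sum λ j → sum (diagonal i j))
          ≡⟨ sym (∑-distrib-+ (λ j → sum (delay i j) + sum λ k → delay i k j) _) ⟩
        (sum λ j → sum (delay i j) + (sum λ k → delay i k j) + sum (diagonal i j))
          ≡⟨ sum-cong-≗ (λ j → trans (cong (_+ sum (diagonal i j)) (sym (∑-distrib-+ (delay i j) _)))
                                     (sym (∑-distrib-+ (λ k → delay i j k + delay i k j) _))) ⟩
        (sum λ j → sum λ k → delay i j k + delay i k j + diagonal i j k)
          ≡⟨ sum-cong-≗ (λ j → sum-cong-≗ (delay-symmetrised i j)) ⟩
        (sum λ j → sum λ k → a i j * a i k)
          ≡⟨ sum-square (a i) ⟨
        load x i * load x i ∎
        where
        open ≡-Reasoning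
        d = sum λ j → sum (delay i j)
        diag : JobIndex jobs → ℝ
        diag j = a i j * a i j
        sum-diagonal : ∀ j → sum (diagonal i j) ≡ diag j
        sum-diagonal j = trans
          (sum-single j λ k k≢j → when-false (j Fin.≟ k) λ { refl → k≢j refl })
          (when-true (j Fin.≟ j) refl λ _ → refl)

      -- Own processing `P` is linear in the fractions, whereas the diagonal `Q` of the squared
      -- loads is quadratic. Since x² ≤ x on the unit interval, `Q` is at most `P` for fractional
      -- solutions, and both agree for integral ones. This is the source of the lower bound for the
      -- algorithm and of the exact formula for the optimum below.
      cost-identity : let κ = cost jobs order x ; P = sum λ i → sum (processing i) in
        κ + κ + (sum λ i → sum λ j → a i j * a i j) ≡ (sum λ i → load x i * load x i) + (P + P)
      cost-identity = begin
        κ + κ + Q                  ≡⟨ cong (λ t → t + t + Q) cost-by-machine ⟩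
        (P + D) + (P + D) + Q      ≡⟨ solve 3 (λ P D Q → (P :+ D) :+ (P :+ D) :+ Q := (D :+ D :+ Q) :+ (P :+ P)) refl P D Q ⟩
        (D + D + Q) + (P + P)      ≡⟨ cong (_+ (P + P)) (begin
          D + D + Q
            ≡⟨ cong (_+ Q) (sym (∑-distrib-+ dᵢ dᵢ)) ⟩
          (sum λ i → dᵢ i + dᵢ i) + Q
            ≡⟨ sym (∑-distrib-+ (λ i → dᵢ i + dᵢ i) _) ⟩
          (sum λ i → dᵢ i + dᵢ i + sum λ j → a i j * a i j)
            ≡⟨ sum-cong-≗ delay-on-machine ⟩
          (sum λ i → load x i * load x i) ∎) ⟩
        (sum λ i → load x i * load x i) + (P + P) ∎
        where
        open ≡-Reasoning
        κ = cost jobs order x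
        P = sum λ i → sum (processing i)
        dᵢ : Fin m → ℝ
        dᵢ i = sum λ j → sum (delay i j)
        D = sum dᵢ
        Q = sum λ i → sum λ j → a i j * a i j

      squaredLoads≤2cost : (sum λ i → load x i * load x i) ≤ cost jobs order x + cost jobs order x
      squaredLoads≤2cost = +-cancelˡ-≤ Q (begin
        Q + L            ≡⟨ +-comm Q L ⟩
        L + Q            ≤⟨ +-monoʳ-≤ L (sum-mono-≤ λ i → sum-mono-≤ λ j → a²≤processing i j) ⟩
        L + P            ≤⟨ +-monoʳ-≤ L (x≤x+y P (sum-nonneg λ i → sum-nonneg λ j → processing-nonneg i j)) ⟩
        L + (P + P)      ≡⟨ cost-identity ⟨
        κ + κ + Q        ≡⟨ +-comm (κ + κ) Q ⟩
        Q + (κ + κ)      ∎)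
        where
        open ≤-Reasoning
        κ = cost jobs order x
        L = sum λ i → load x i * load x i
        P = sum λ i → sum (processing i)
        Q = sum λ i → sum λ j → a i j * a i j
        processing-nonneg : ∀ i j → 0ℝ ≤ processing i j
        processing-nonneg i j = *-nonneg (square-nonneg (w jobs j)) (frac≥0 (x j) i)
        a²≤processing : ∀ i j → a i j * a i j ≤ processing i j
        a²≤processing i j = begin
          a i j * a i j                     ≡⟨ solve 2 (λ w x → w :* x :* (w :* x) := w :* w :* x :* x) refl (w jobs j) (frac (x j) i) ⟩
          processing i j * frac (x j) i     ≤⟨ *-monoʳ-≤ (processing-nonneg i j) (frac≤1 (x j) i) ⟩
          processing i j * 1ℝ               ≡⟨ *-identityʳ _ ⟩
          processing i j                    ∎

      2cost-integral : (∀ j → Integral (x j)) →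
        cost jobs order x + cost jobs order x ≡ (sum λ i → load x i * load x i) + (sum λ j → w jobs j * w jobs j)
      2cost-integral integral = begin
        κ + κ          ≡⟨ +-cancelˡ P (trans (+-comm P (κ + κ)) (trans (cong (κ + κ +_) (sym Q≡P)) (trans cost-identity
                             (solve 2 (λ L P → L :+ (P :+ P) := P :+ (L :+ P)) refl L P)))) ⟩
        L + P          ≡⟨ cong (L +_) P≡Σw² ⟩
        L + (sum λ j → w jobs j * w jobs j) ∎
        where
        open ≡-Reasoning
        κ = cost jobs order x
        L = sum λ i → load x i * load x i
        P = sum λ i → sum (processing i)
        Q = sum λ i → sum λ j → a i j * a i j
        x²≡x : ∀ j i → frac (x j) i * frac (x j) i ≡ frac (x j) i
        x²≡x j i with integral j i
        ... | inj₁ x≡0 rewrite x≡0 = zeroˡ 0ℝ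
        ... | inj₂ x≡1 rewrite x≡1 = *-identityˡ 1ℝ
        Q≡P : Q ≡ P
        Q≡P = sum-cong-≗ λ i → sum-cong-≗ λ j → trans
          (solve 2 (λ w x → w :* x :* (w :* x) := w :* w :* (x :* x)) refl (w jobs j) (frac (x j) i))
          (cong (w jobs j * w jobs j *_) (x²≡x j i))
        P≡Σw² : P ≡ sum λ j → w jobs j * w jobs j
        P≡Σw² = trans (∑-comm processing) (sum-cong-≗ λ j →
          trans (sym (*-distribˡ-sum (w jobs j * w jobs j) (frac (x j))))
          (trans (cong (w jobs j * w jobs j *_) (sum-frac j)) (*-identityʳ _)))
          where
          sum-frac : ∀ j → sum (frac (x j)) ≡ 1ℝ
          sum-frac j = trans (sum-cong-≗ restrict) (total (x j))
            where
            restrict : ∀ i → frac (x j) i ≡ when (i ∈? S jobs j) λ _ → frac (x j) i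
            restrict i with i ∈? S jobs j
            ... | yes _   = refl
            ... | no i∉Sⱼ = supports (x j) i i∉Sⱼ

-- The adaptive adversary and the loads that it forces

module Adversary {c ℓ} (ℛ : Reals c ℓ) where

  open import Data.Fin.Subset using (_-_)
  open Reals ℛ hiding (_-_)
  open Scheduling ℛ
  open OrderedFieldProperties orderedField
  open CentralBinomial orderedField
  open CostIdentity ℛ

  totalOrder : TotalOrder c c ℓ
  totalOrder = record { isTotalOrder = IsDecTotalOrder.isTotalOrder isDecTotalOrder }

  module Argmin = Extrema totalOrder

  private variable
    m : ℕ

  x∉p-x : ∀ {x : Fin m} p → x ∉ p - x
  x∉p-x {x = zero}  (_ ∷ _) ()
  x∉p-x {x = suc x} (inside  ∷ p) (there x∈) = x∉p-x p x∈
  x∉p-x {x = suc x} (outside ∷ p) (there x∈) = x∉p-x p x∈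

  sumOn : Subset m → (Fin m → ℝ) → ℝ
  sumOn A f = sumOver A λ i _ → f i

  sumOn-cong : ∀ (A : Subset m) {f g} → (∀ i → f i ≡ g i) → sumOn A f ≡ sumOn A g
  sumOn-cong A f≡g = sum-cong-≗ λ i → when-cong (i ∈? A) λ _ → f≡g i

  sumOn-mono-≤ : ∀ (A : Subset m) {f g} → (∀ i → i ∈ A → f i ≤ g i) → sumOn A f ≤ sumOn A g
  sumOn-mono-≤ A {f} {g} f≤g = sum-mono-≤ pointwise
    where
    pointwise : ∀ i → when (i ∈? A) (λ _ → f i) ≤ when (i ∈? A) (λ _ → g i)
    pointwise i with i ∈? A
    ... | yes i∈A = f≤g i i∈A
    ... | no _    = ≤-refl

  sumOn-+ : ∀ (A : Subset m) f g → sumOn A (λ i → f i + g i) ≡ sumOn A f + sumOn A g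
  sumOn-+ {m} A f g = trans (sum-cong-≗ pointwise) (∑-distrib-+ {m} _ _)
    where
    pointwise : ∀ i → when (i ∈? A) (λ _ → f i + g i) ≡ when (i ∈? A) (λ _ → f i) + when (i ∈? A) (λ _ → g i)
    pointwise i with i ∈? A
    ... | yes _ = refl
    ... | no _  = sym (+-identityˡ 0ℝ)

  *-sumOn : ∀ (A : Subset m) x f → x * sumOn A f ≡ sumOn A (λ i → x * f i)
  *-sumOn {m} A x f = trans (*-distribˡ-sum {m} x _) (sum-cong-≗ λ i → *-when (i ∈? A) x)

  sumOn-⊤ : ∀ (f : Fin m → ℝ) → sumOn ⊤ f ≡ sum f
  sumOn-⊤ {m} f = sum-cong-≗ {m} λ i → when-true (i ∈? ⊤) ∈⊤ λ _ → refl

  sumOn-empty : ∀ (A : Subset m) f → ¬ Nonempty A → sumOn A f ≡ 0ℝ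
  sumOn-empty A f empty = sum-zero λ i → when-false (i ∈? A) λ i∈A → empty (i , i∈A)

  sumOn-remove : ∀ {A : Subset m} {i} → i ∈ A → ∀ f → sumOn A f ≡ f i + sumOn (A - i) f
  sumOn-remove {m} {A} {i} i∈A f = begin
    sumOn A f                                        ≡⟨ sum-cong-≗ pointwise ⟩
    (sum λ k → at-i k + when (k ∈? A - i) λ _ → f k) ≡⟨ ∑-distrib-+ at-i _ ⟩
    sum at-i + sumOn (A - i) f                       ≡⟨ cong (_+ sumOn (A - i) f) (trans
      (sum-single i λ k k≢i → when-false (k Fin.≟ i) k≢i) (when-true (i Fin.≟ i) refl λ _ → refl)) ⟩
    f i + sumOn (A - i) f                            ∎
    where
    open ≡-Reasoning
    at-i : Fin m → ℝ
    at-i k = when (k Fin.≟ i) λ _ → f k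

    pointwise : ∀ k → when (k ∈? A) (λ _ → f k) ≡ at-i k + when (k ∈? A - i) λ _ → f k
    pointwise k with k Fin.≟ i
    ... | yes refl = trans (when-true (i ∈? A) i∈A λ _ → refl)
      (sym (trans (cong (f i +_) (when-false (i ∈? A - i) (x∉p-x A))) (+-identityʳ (f i))))
    ... | no k≢i with k ∈? A
    ...   | yes k∈A = sym (trans (+-identityˡ _) (when-true (k ∈? A - i) (x∈p∧x≢y⇒x∈p-y k∈A k≢i) λ _ → refl))
    ...   | no k∉A  = sym (trans (+-identityˡ _) (when-false (k ∈? A - i) (k∉A ∘ p─q⊆p A ⁅ i ⁆)))

  -- Cardinality as a real number, written as a sum so that `sumOn-remove` also governs the number
  -- of active machines.
  count : Subset m → ℝ
  count A = sumOn A λ _ → 1ℝ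

  count-nonneg : ∀ (A : Subset m) → 0ℝ ≤ count A
  count-nonneg A = sum-nonneg pointwise
    where
    pointwise : ∀ i → 0ℝ ≤ when (i ∈? A) (λ _ → 1ℝ)
    pointwise i with i ∈? A
    ... | yes _ = 0≤1
    ... | no _  = ≤-refl

  count-⊤ : ∀ m → count (⊤ {m}) ≡ fromℕ m
  count-⊤ m = trans (sumOn-⊤ {m} λ _ → 1ℝ) (ones m)
    where
    ones : ∀ m → sum {m} (λ _ → 1ℝ) ≡ fromℕ m
    ones zero    = refl
    ones (suc m) = cong (1ℝ +_) (ones m)

  1≤count : ∀ {A : Subset m} {i} → i ∈ A → 1ℝ ≤ count A
  1≤count {A = A} {i} i∈A = subst (1ℝ ≤_) (sym (sumOn-remove i∈A λ _ → 1ℝ)) (x≤x+y 1ℝ (count-nonneg (A - i)))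

  count-remove : ∀ {A : Subset m} {i k} → i ∈ A → count A ≡ fromℕ (suc k) → count (A - i) ≡ fromℕ k
  count-remove i∈A count≡ = +-cancelˡ 1ℝ (trans (sym (sumOn-remove i∈A λ _ → 1ℝ)) count≡)

  count≡0⇒empty : ∀ {A : Subset m} → count A ≡ 0ℝ → ¬ Nonempty A
  count≡0⇒empty count≡0 (_ , i∈A) = 1≤⇒≢0 (1≤count i∈A) count≡0

  count≡suc⇒nonempty : ∀ {A : Subset m} {k} → count A ≡ fromℕ (suc k) → Nonempty A
  count≡suc⇒nonempty {A = A} {k} count≡ with nonempty? A
  ... | yes nonempty = nonempty
  ... | no empty     = contradiction (trans (sym count≡) (sumOn-empty A _ empty)) (1≤⇒≢0 (1≤fromℕ-suc k))

  -- A minimum is at most the average, here multiplied out to avoid a division. Besides the total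
  -- load of a phase, this is all that the phase inequality needs to know about how the algorithm
  -- has split the load.
  least : ∀ (f : Fin m → ℝ) (A : Subset m) → Nonempty A →
          ∃ λ i → i ∈ A × count A * f i ≤ sumOn A f
  least {m} f A (i₀ , i₀∈A) = i , i∈A , (begin
    count A * f i                   ≡⟨ *-comm (count A) (f i) ⟩
    f i * count A                   ≡⟨ *-sumOn A (f i) _ ⟩
    sumOn A (λ _ → f i * 1ℝ)        ≤⟨ sumOn-mono-≤ A (λ k k∈A → subst (_≤ f k) (sym (*-identityʳ (f i))) (minimal k∈A)) ⟩
    sumOn A f                       ∎)
    where
    open ≤-Reasoning
    candidates : List (Fin m)
    candidates = filter (_∈? A) (allFin m)
    i : Fin m
    i = Argmin.argmin f i₀ candidates
    i∈A : i ∈ A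
    i∈A = Argmin.argmin-all f i₀∈A (all-filter (_∈? A) (allFin m))
    minimal : ∀ {k} → k ∈ A → f i ≤ f k
    minimal {k} k∈A = All.lookup (Argmin.f[argmin]≤f[xs] i₀ candidates) (∈-filter⁺ (_∈? A) (∈-allFin k) k∈A)

  IntegralAssignment : Job m → Set (c ⊔ ℓ)
  IntegralAssignment J = ∃ λ (a : Assignment J) → Integral a

  indicator : Fin m → Fin m → ℝ
  indicator i k = when (k Fin.≟ i) λ _ → 1ℝ

  assignTo : ∀ (J : Job m) i → i ∈ feasible J → IntegralAssignment J
  assignTo J i i∈S = record
    { frac     = indicator i
    ; frac≥0   = nonneg
    ; frac≤1   = ≤1
    ; total    = trans (sum-single i λ k k≢i → trans
                   (when-cong (k ∈? feasible J) λ _ → when-false (k Fin.≟ i) k≢i) (when-zero (k ∈? feasible J)))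
                   (when-true (i ∈? feasible J) i∈S λ _ → when-true (i Fin.≟ i) refl λ _ → refl)
    ; supports = λ k k∉S → when-false (k Fin.≟ i) λ { refl → k∉S i∈S }
    } , integral
    where
    nonneg : ∀ k → 0ℝ ≤ indicator i k
    nonneg k with k Fin.≟ i
    ... | yes _ = 0≤1
    ... | no _  = ≤-refl
    ≤1 : ∀ k → indicator i k ≤ 1ℝ
    ≤1 k with k Fin.≟ i
    ... | yes _ = ≤-refl
    ... | no _  = 0≤1
    integral : ∀ k → indicator i k ≡ 0ℝ ⊎ indicator i k ≡ 1ℝ
    integral k with k Fin.≟ i
    ... | yes _ = inj₂ refl
    ... | no _  = inj₁ refl

  lookupAll : ∀ {a p} {A : Set a} {P : A → Set p} {xs} → All P xs → ∀ j → P (lookup xs j)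
  lookupAll (px ∷ _)  zero    = px
  lookupAll (_ ∷ pxs) (suc j) = lookupAll pxs j

  integralSolution : ∀ {jobs : List (Job m)} → All IntegralAssignment jobs → Solution jobs
  integralSolution y j = proj₁ (lookupAll y j)

  -- For an algorithm A and a prefix xs of the instance, λ ys → A m (xs ++ ys) is
  -- again a strategy, so the adversary's recursion need not mention the prefix.
  Strategy : ℕ → Set (c ⊔ ℓ)
  Strategy m = List (Job m) → (J : Job m) → Assignment J

  play : Strategy m → ∀ jobs → Solution jobs
  play B jobs j = B (take (toℕ j) jobs) (lookup jobs j)

  load-play-++ : ∀ (B : Strategy m) xs ys i →
    load (xs ++ ys) (play B (xs ++ ys)) i ≡ load xs (play B xs) i + load ys (play (B ∘ (xs ++_)) ys) i
  load-play-++ B []       ys i = sym (+-identityˡ _)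
  load-play-++ B (J ∷ xs) ys i = trans
    (cong (weight J * frac (B [] J) i +_) (load-play-++ (B ∘ (J ∷_)) xs ys i)) (sym (+-assoc _ _ _))

  load-++ : ∀ {xs ys : List (Job m)} (y : All IntegralAssignment xs) (z : All IntegralAssignment ys) i →
    load (xs ++ ys) (integralSolution (++⁺ y z)) i ≡ load xs (integralSolution y) i + load ys (integralSolution z) i
  load-++ []      z i = sym (+-identityˡ _)
  load-++ {xs = J ∷ xs} (a ∷ y) z i = trans
    (cong (weight J * frac (proj₁ a) i +_) (load-++ y z i)) (sym (+-assoc _ _ _))

  load-replicate : ∀ n {J : Job m} (a : IntegralAssignment J) i →
    load (replicate n J) (integralSolution (replicate⁺ n a)) i ≡ fromℕ n * (weight J * frac (proj₁ a) i)
  load-replicate zero    a i = sym (zeroˡ _)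
  load-replicate (suc n) {J} a i = trans (cong (weight J * frac (proj₁ a) i +_) (load-replicate n a i))
    (solve 2 (λ n x → x :+ n :* x := (con 1 :+ n) :* x) refl (fromℕ n) (weight J * frac (proj₁ a) i))

  -- However the strategy reacts to the earlier copies, each answer distributes one full unit over
  -- the feasible machines.
  play-replicate : ∀ n (J : Job m) (B : Strategy m) →
    sumOn (feasible J) (load (replicate n J) (play B (replicate n J))) ≡ fromℕ n * weight J
  play-replicate zero    J B = trans (sum-zero λ i → when-zero (i ∈? feasible J)) (sym (zeroˡ (weight J)))
  play-replicate (suc n) J B = begin
    sumOn (feasible J) (λ i → weight J * frac (B [] J) i + rest i)
      ≡⟨ sumOn-+ (feasible J) _ rest ⟩
    sumOn (feasible J) (λ i → weight J * frac (B [] J) i) + sumOn (feasible J) rest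
      ≡⟨ cong₂ _+_ (sym (*-sumOn (feasible J) (weight J) _)) (play-replicate n J (B ∘ (J ∷_))) ⟩
    weight J * sumOn (feasible J) (frac (B [] J)) + fromℕ n * weight J
      ≡⟨ cong (λ t → weight J * t + fromℕ n * weight J) (total (B [] J)) ⟩
    weight J * 1ℝ + fromℕ n * weight J
      ≡⟨ solve 2 (λ n w → w :* con 1 :+ n :* w := (con 1 :+ n) :* w) refl (fromℕ n) (weight J) ⟩
    fromℕ (suc n) * weight J ∎
    where
    open ≡-Reasoning
    rest = load (replicate n J) (play (B ∘ (J ∷_)) (replicate n J))

  -- By `2cost-integral` this is the part of twice the cost that all integral solutions share.
  squaredWeights : List (Job m) → ℝ
  squaredWeights jobs = sum λ j → w jobs j * w jobs j

  squaredWeights-replicate-++ : ∀ n (J : Job m) ys →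
    squaredWeights (replicate n J ++ ys) ≡ squaredWeights ys + fromℕ n * (weight J * weight J)
  squaredWeights-replicate-++ zero    J ys = sym (trans (cong (squaredWeights ys +_) (zeroˡ _)) (+-identityʳ _))
  squaredWeights-replicate-++ (suc n) J ys = trans
    (cong (weight J * weight J +_) (squaredWeights-replicate-++ n J ys))
    (solve 3 (λ n s v → v :+ (s :+ n :* v) := s :+ (con 1 :+ n) :* v) refl (fromℕ n) (squaredWeights ys) (weight J * weight J))

  unitRatioJob : ∀ (A : Subset m) v → 0ℝ ≤ v → Nonempty A → Job m
  unitRatioJob A v 0≤v nonempty = record
    { weight = v ; feasible = A ; time = λ _ _ → v ; weight≥0 = 0≤v ; nonempty = nonempty ; time≥0 = λ _ _ → 0≤v }

  -- Here μ + κ is the final load of the machine removed in the phase, of which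
  -- μ is its load at the end of the phase; t and t″ are the loads of the
  -- active machines before the phase and of the surviving ones after it, and
  -- σ is the sum of the squared final loads of the survivors.
  phase-inequality : ∀ k {n t t″ μ κ σ} → 0ℝ ≤ n → 0ℝ ≤ κ →
    t + n * b (suc k) ≡ μ + t″ →
    fromℕ (suc k) * μ ≤ μ + t″ →
    lit 8 * n * b k * t″ + lit 8 * (n * n) * squares k ≤ σ + lit 4 * (n * n) * squares₀ k →
    lit 8 * n * b (suc k) * t + lit 8 * (n * n) * squares (suc k)
      ≤ (μ + κ) * (μ + κ) + σ + lit 4 * (n * n) * squares₀ (suc k)
  phase-inequality k {n} {t} {t″} {μ} {κ} {σ} 0≤n 0≤κ t+nb≡μ+t″ [k+1]μ≤μ+t″ ih = begin
    lit 8 * n * b′ * t + lit 8 * (n * n) * (q + b′ * b′)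
      ≡⟨ solve 4 (λ n b′ t q → con 8 :* n :* b′ :* t :+ con 8 :* (n :* n) :* (q :+ b′ :* b′)
                   := con 4 :* n :* (con 2 :* b′ :* (t :+ n :* b′)) :+ con 8 :* (n :* n) :* q) refl n b′ t q ⟩
    lit 4 * n * (lit 2 * b′ * (t + n * b′)) + lit 8 * (n * n) * q
      ≡⟨ cong (λ s → lit 4 * n * (lit 2 * b′ * s) + lit 8 * (n * n) * q) t+nb≡μ+t″ ⟩
    lit 4 * n * (lit 2 * b′ * (μ + t″)) + lit 8 * (n * n) * q
      ≤⟨ +-monoˡ-≤ _ (*-monoʳ-≤ 0≤4n balance) ⟩
    lit 4 * n * (lit 2 * b k * t″ + b k * μ) + lit 8 * (n * n) * q
      ≡⟨ solve 5 (λ n b t″ μ q → con 4 :* n :* (con 2 :* b :* t″ :+ b :* μ) :+ con 8 :* (n :* n) :* q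
                   := (con 8 :* n :* b :* t″ :+ con 8 :* (n :* n) :* q) :+ con 4 :* n :* b :* μ) refl n (b k) t″ μ q ⟩
    (lit 8 * n * b k * t″ + lit 8 * (n * n) * q) + lit 4 * n * b k * μ
      ≤⟨ +-mono-≤ ih tangent ⟩
    (σ + lit 4 * (n * n) * squares₀ k) + (lit 2 * n * b k * (lit 2 * n * b k) + (μ + κ) * (μ + κ))
      ≡⟨ solve 5 (λ n b x σ d → (σ :+ con 4 :* (n :* n) :* d) :+ (con 2 :* n :* b :* (con 2 :* n :* b) :+ x :* x)
                   := x :* x :+ σ :+ con 4 :* (n :* n) :* (d :+ b :* b)) refl n (b k) (μ + κ) σ (squares₀ k) ⟩
    (μ + κ) * (μ + κ) + σ + lit 4 * (n * n) * squares₀ (suc k) ∎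
    where
    open ≤-Reasoning
    b′ = b (suc k)
    q = squares k
    0≤4n : 0ℝ ≤ lit 4 * n
    0≤4n = *-nonneg (lit-nonneg 4) 0≤n

    -- The tangent bound concerns the final load μ + κ, but only μ is kept. As `0 ≤ κ` suffices for
    -- this, nothing about later jobs on the removed machine has to be tracked.
    tangent : lit 4 * n * b k * μ ≤ lit 2 * n * b k * (lit 2 * n * b k) + (μ + κ) * (μ + κ)
    tangent = begin
      lit 4 * n * b k * μ                      ≤⟨ *-monoʳ-≤ (*-nonneg 0≤4n (b-nonneg k)) (x≤x+y μ 0≤κ) ⟩
      lit 4 * n * b k * (μ + κ)                ≡⟨ solve 3 (λ n b x → con 4 :* n :* b :* x := con 2 :* (con 2 :* n :* b :* x)) refl n (b k) (μ + κ) ⟩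
      lit 2 * (lit 2 * n * b k * (μ + κ))      ≤⟨ 2xy≤x²+y² (lit 2 * n * b k) (μ + κ) ⟩
      lit 2 * n * b k * (lit 2 * n * b k) + (μ + κ) * (μ + κ) ∎

    bμ≤2e[μ+t″] : b k * μ ≤ lit 2 * e k * (μ + t″)
    bμ≤2e[μ+t″] = begin
      b k * μ                                 ≡⟨ cong (_* μ) (b≡e*denominator k) ⟩
      e k * denominator k * μ                 ≡⟨ solve 3 (λ e r μ → e :* (con 2 :* r) :* μ := con 2 :* e :* (r :* μ)) refl (e k) (fromℕ (suc k)) μ ⟩
      lit 2 * e k * (fromℕ (suc k) * μ)       ≤⟨ *-monoʳ-≤ (*-nonneg (lit-nonneg 2) (e-nonneg k)) [k+1]μ≤μ+t″ ⟩
      lit 2 * e k * (μ + t″)                  ∎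

    -- The coefficient rises from 2 b(k+1) to 2 b(k) on the survivors and drops to b(k) on the
    -- removed machine. The rise is worth 2 e(k) (μ + t″) in all, the removal costs b(k) μ, and
    -- `e k` = b(k) / (2(k+1)) makes the two equal when μ is exactly the average.
    balance : lit 2 * b′ * (μ + t″) ≤ lit 2 * b k * t″ + b k * μ
    balance = +-cancelˡ-≤ (b k * μ) (begin
      b k * μ + lit 2 * b′ * (μ + t″)                  ≤⟨ +-monoˡ-≤ _ bμ≤2e[μ+t″] ⟩
      lit 2 * e k * (μ + t″) + lit 2 * b′ * (μ + t″)   ≡⟨ solve 3 (λ e b′ s → con 2 :* e :* s :+ con 2 :* b′ :* s := con 2 :* (b′ :+ e) :* s) refl (e k) b′ (μ + t″) ⟩
      lit 2 * (b′ + e k) * (μ + t″)                    ≡⟨ cong (λ s → lit 2 * s * (μ + t″)) (b≡b+e k) ⟨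
      lit 2 * b k * (μ + t″)                           ≡⟨ solve 3 (λ b μ t″ → con 2 :* b :* (μ :+ t″) := b :* μ :+ (con 2 :* b :* t″ :+ b :* μ)) refl (b k) μ t″ ⟩
      b k * μ + (lit 2 * b k * t″ + b k * μ)           ∎)

  -- A game resumed with r active machines `A` carrying the loads `current`; arbitrary `current` is
  -- what the induction requires. In `alg-load` a machine removed with j survivors has tangent slope
  -- 4 n b(j), and 8 n b(r) is the average of these slopes over j < r: the value of a unit of load
  -- spread evenly over `A`. `opt-supports` keeps the machine of a phase free of the later phases in
  -- the reference solution.
  record Attack (n : ℝ) (r : ℕ) (A : Subset m) (current : Fin m → ℝ) (B : Strategy m) : Set (c ⊔ ℓ) where
    field
      jobs           : List (Job m)
      unitRatio      : All UnitRatio jobs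
      opt            : All IntegralAssignment jobs
      opt-load       : (sum λ i → load jobs (integralSolution opt) i * load jobs (integralSolution opt) i) ≡ n * n * squares r
      opt-supports   : ∀ i → i ∉ A → load jobs (integralSolution opt) i ≡ 0ℝ
      opt-weights    : squaredWeights jobs ≡ n * squares r

    final : Fin m → ℝ
    final i = current i + load jobs (play B jobs) i

    field
      alg-load       : lit 8 * n * b r * sumOn A current + lit 8 * (n * n) * squares r
                         ≤ sumOn A (λ i → final i * final i) + lit 4 * (n * n) * squares₀ r

  -- The cross term vanishes because z is zero wherever the indicator is one.
  square-add-indicator : ∀ {p} {P : Set p} (P? : Dec P) x y {z} → (P → z ≡ 0ℝ) →
    let e = x * (y * when P? λ _ → 1ℝ) in (e + z) * (e + z) ≡ z * z + when P? λ _ → x * y * (x * y)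
  square-add-indicator (yes p) x y z≡0 with refl ← z≡0 p =
    solve 2 (λ x y → (x :* (y :* con 1) :+ con 0) :* (x :* (y :* con 1) :+ con 0) := con 0 :* con 0 :+ x :* y :* (x :* y)) refl x y
  square-add-indicator (no _) x y {z} _ =
    solve 3 (λ x y z → (x :* (y :* con 0) :+ z) :* (x :* (y :* con 0) :+ z) := z :* z :+ con 0) refl x y z

  module Extend {m : ℕ} (n k : ℕ) (A : Subset m) (current : Fin m → ℝ) (B : Strategy m) (A-nonempty : Nonempty A) where

    open ≡-Reasoning
    ν v : ℝ
    ν = fromℕ n
    v = b (suc k)

    J : Job m
    J = unitRatioJob A v (b-nonneg (suc k)) A-nonempty

    phase : List (Job m)
    phase = replicate n J

    phaseLoad current′ : Fin m → ℝ
    phaseLoad = load phase (play B phase)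
    current′ i = current i + phaseLoad i

    B′ : Strategy m
    B′ = B ∘ (phase ++_)

    module _ (i* : Fin m) (i*∈A : i* ∈ A) (average : fromℕ (suc k) * current′ i* ≤ sumOn A current′)
             (rest : Attack (fromℕ n) k (A - i*) current′ B′) where

      private module Rest = Attack rest

      sumOn-current′ : sumOn A current′ ≡ current′ i* + sumOn (A - i*) current′
      sumOn-current′ = sumOn-remove i*∈A current′

      total-load : sumOn A current + ν * v ≡ current′ i* + sumOn (A - i*) current′
      total-load = begin
        sumOn A current + ν * v               ≡⟨ cong (sumOn A current +_) (play-replicate n J B) ⟨
        sumOn A current + sumOn A phaseLoad   ≡⟨ sumOn-+ A current phaseLoad ⟨
        sumOn A current′                      ≡⟨ sumOn-current′ ⟩
        current′ i* + sumOn (A - i*) current′ ∎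

      final : Fin m → ℝ
      final i = current i + load (phase ++ Rest.jobs) (play B (phase ++ Rest.jobs)) i

      final≡ : ∀ i → final i ≡ Rest.final i
      final≡ i = trans (cong (current i +_) (load-play-++ B phase Rest.jobs i)) (sym (+-assoc (current i) (phaseLoad i) _))

      final-squares : sumOn A (λ i → final i * final i) ≡
        Rest.final i* * Rest.final i* + sumOn (A - i*) (λ i → Rest.final i * Rest.final i)
      final-squares = trans (sumOn-cong A λ i → cong (λ t → t * t) (final≡ i))
        (sumOn-remove i*∈A λ i → Rest.final i * Rest.final i)

      phaseOpt : All IntegralAssignment phase
      phaseOpt = replicate⁺ n (assignTo J i* i*∈A)

      restLoad at-i* : Fin m → ℝ
      restLoad = load Rest.jobs (integralSolution Rest.opt)
      at-i* i = when (i Fin.≟ i*) λ _ → ν * v * (ν * v)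

      optLoad : ∀ i → load (phase ++ Rest.jobs) (integralSolution (++⁺ phaseOpt Rest.opt)) i ≡ ν * (v * indicator i* i) + restLoad i
      optLoad i = trans (load-++ phaseOpt Rest.opt i) (cong (_+ restLoad i) (load-replicate n (assignTo J i* i*∈A) i))

      squared-load : ∀ i → load (phase ++ Rest.jobs) (integralSolution (++⁺ phaseOpt Rest.opt)) i
                         * load (phase ++ Rest.jobs) (integralSolution (++⁺ phaseOpt Rest.opt)) i
                         ≡ restLoad i * restLoad i + at-i* i
      squared-load i = trans (cong (λ t → t * t) (optLoad i))
        (square-add-indicator (i Fin.≟ i*) ν v λ { refl → Rest.opt-supports i* (x∉p-x A) })

      extended : Attack ν (suc k) A current B
      extended = record
        { jobs         = phase ++ Rest.jobs
        ; unitRatio    = ++⁺ (replicate⁺ n (λ _ _ → refl)) Rest.unitRatio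
        ; opt          = ++⁺ phaseOpt Rest.opt
        ; opt-load     = begin
            (sum λ i → load (phase ++ Rest.jobs) (integralSolution (++⁺ phaseOpt Rest.opt)) i * load (phase ++ Rest.jobs) (integralSolution (++⁺ phaseOpt Rest.opt)) i)
              ≡⟨ sum-cong-≗ squared-load ⟩
            (sum λ i → restLoad i * restLoad i + at-i* i)
              ≡⟨ ∑-distrib-+ (λ i → restLoad i * restLoad i) at-i* ⟩
            (sum λ i → restLoad i * restLoad i) + sum at-i*
              ≡⟨ cong₂ _+_ Rest.opt-load (trans (sum-single i* λ i i≢i* → when-false (i Fin.≟ i*) i≢i*)
                   (when-true (i* Fin.≟ i*) refl λ _ → refl)) ⟩
            ν * ν * squares k + ν * v * (ν * v)
              ≡⟨ solve 3 (λ n q v → n :* n :* q :+ n :* v :* (n :* v) := n :* n :* (q :+ v :* v)) refl ν (squares k) v ⟩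
            ν * ν * squares (suc k) ∎
        ; opt-supports = λ i i∉A → trans (optLoad i) (trans (cong₂ _+_
            (trans (cong (λ t → ν * (v * t)) (when-false (i Fin.≟ i*) λ { refl → i∉A i*∈A }))
              (solve 2 (λ n v → n :* (v :* con 0) := con 0) refl ν v))
            (Rest.opt-supports i (i∉A ∘ p─q⊆p A ⁅ i* ⁆))) (+-identityˡ 0ℝ))
        ; opt-weights  = trans (squaredWeights-replicate-++ n J Rest.jobs)
            (trans (cong (_+ ν * (v * v)) Rest.opt-weights) (sym (distribˡ ν (squares k) (v * v))))
        ; alg-load     = subst (λ t → lit 8 * ν * b (suc k) * sumOn A current + lit 8 * (ν * ν) * squares (suc k)
                                        ≤ t + lit 4 * (ν * ν) * squares₀ (suc k))
            (sym final-squares)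
            (phase-inequality k (fromℕ-nonneg n) (load-nonneg Rest.jobs (play B′ Rest.jobs) i*) total-load (subst (fromℕ (suc k) * current′ i* ≤_) sumOn-current′ average) Rest.alg-load)
        }

  -- A deterministic algorithm can be simulated: its loads `current′` after a phase are known before
  -- the feasible set `A - i*` of the next phase is fixed, so the adaptive game yields a fixed list
  -- of jobs.
  attack : ∀ n r (A : Subset m) current B → count A ≡ fromℕ r → Attack (fromℕ n) r A current B
  attack {m} n zero A current B count≡0 = record
    { jobs         = []
    ; unitRatio    = []
    ; opt          = []
    ; opt-load     = trans (sum-zero {m} λ _ → zeroˡ 0ℝ) (sym (zeroʳ _))
    ; opt-supports = λ _ _ → refl
    ; opt-weights  = sym (zeroʳ (fromℕ n))
    ; alg-load     = ≤-reflexive (begin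
        lit 8 * fromℕ n * 1ℝ * sumOn A current + lit 8 * (fromℕ n * fromℕ n) * 0ℝ
          ≡⟨ cong (λ t → lit 8 * fromℕ n * 1ℝ * t + lit 8 * (fromℕ n * fromℕ n) * 0ℝ) (sumOn-empty A current empty) ⟩
        lit 8 * fromℕ n * 1ℝ * 0ℝ + lit 8 * (fromℕ n * fromℕ n) * 0ℝ
          ≡⟨ solve 1 (λ n → con 8 :* n :* con 1 :* con 0 :+ con 8 :* (n :* n) :* con 0 := con 0 :+ con 4 :* (n :* n) :* con 0) refl (fromℕ n) ⟩
        0ℝ + lit 4 * (fromℕ n * fromℕ n) * 0ℝ
          ≡⟨ cong (_+ lit 4 * (fromℕ n * fromℕ n) * 0ℝ) (sumOn-empty A _ empty) ⟨
        sumOn A (λ i → (current i + 0ℝ) * (current i + 0ℝ)) + lit 4 * (fromℕ n * fromℕ n) * 0ℝ ∎)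
    }
    where
    open ≡-Reasoning
    empty : ¬ Nonempty A
    empty = count≡0⇒empty count≡0
  attack n (suc k) A current B count≡ = extended i* i*∈A
    (subst (λ t → t * current′ i* ≤ sumOn A current′) count≡ count*least≤)
    (attack n k (A - i*) current′ B′ (count-remove {k = k} i*∈A count≡))
    where
    A-nonempty = count≡suc⇒nonempty {k = k} count≡
    open Extend n k A current B A-nonempty
    chosen = least current′ A A-nonempty
    i* = proj₁ chosen
    i*∈A = proj₁ (proj₂ chosen)
    count*least≤ = proj₂ (proj₂ chosen)

-- Existence of an optimal integral solution, and the competitive ratio

module LowerBound {c ℓ} (ℛ : Reals c ℓ) where

  open Reals ℛ
  open Scheduling ℛ
  open OrderedFieldProperties orderedField
  open CentralBinomial orderedField
  open CostIdentity ℛ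
  open Adversary ℛ
  open ≤-Reasoning

  private variable
    m : ℕ

  feasible-frac-nonneg : ∀ {J : Job m} (a : Assignment J) i → 0ℝ ≤ when (i ∈? feasible J) λ _ → frac a i
  feasible-frac-nonneg {J = J} a i with i ∈? feasible J
  ... | yes _ = frac≥0 a i
  ... | no _  = ≤-refl

  -- A second machine with fraction 1 would raise the total of the job to at least 2.
  frac-unique : ∀ {J : Job m} (a : Assignment J) {i} → frac a i ≡ 1ℝ → i ∈ feasible J →
                ∀ k → Integral a → k ≢ i → frac a k ≡ 0ℝ
  frac-unique {J = J} a {i} aᵢ≡1 i∈S k integral k≢i with integral k
  ... | inj₁ aₖ≡0 = aₖ≡0
  ... | inj₂ aₖ≡1 = contradiction (≤-antisym 0≤1 (+-cancelˡ-≤ 1ℝ 2≤1+0)) 0≢1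
    where
    sum-indicator : ∀ i → sum (indicator i) ≡ 1ℝ
    sum-indicator i = trans (sum-single i λ j j≢i → when-false (j Fin.≟ i) j≢i)
      (when-true (i Fin.≟ i) refl λ _ → refl)
    pointwise : ∀ j → indicator i j + indicator k j ≤ when (j ∈? feasible J) λ _ → frac a j
    pointwise j with j Fin.≟ i | j Fin.≟ k
    ... | yes refl | yes refl = contradiction refl k≢i
    ... | yes refl | no _     = ≤-reflexive (trans (+-identityʳ 1ℝ) (sym (when-true (i ∈? feasible J) i∈S λ _ → aᵢ≡1)))
    ... | no _     | no _     = ≤-trans (≤-reflexive (+-identityˡ 0ℝ)) (feasible-frac-nonneg a j)
    ... | no _     | yes refl with k ∈? feasible J
    ...   | yes _  = ≤-reflexive (trans (+-identityˡ 1ℝ) (sym aₖ≡1))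
    ...   | no k∉S = contradiction (trans (sym (supports a k k∉S)) aₖ≡1) 0≢1
    2≤1+0 : 1ℝ + 1ℝ ≤ 1ℝ + 0ℝ
    2≤1+0 = begin
      1ℝ + 1ℝ                                      ≡⟨ cong₂ _+_ (sum-indicator i) (sum-indicator k) ⟨
      sum (indicator i) + sum (indicator k)        ≡⟨ ∑-distrib-+ (indicator i) (indicator k) ⟨
      (sum λ j → indicator i j + indicator k j)    ≤⟨ sum-mono-≤ pointwise ⟩
      sumOver (feasible J) (λ j _ → frac a j)      ≡⟨ total a ⟩
      1ℝ                                           ≡⟨ +-identityʳ 1ℝ ⟨
      1ℝ + 0ℝ                                      ∎

  choicesOn : ∀ (J : Job m) i → Dec (i ∈ feasible J) → List (IntegralAssignment J)
  choicesOn J i (yes i∈S) = [ assignTo J i i∈S ]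
  choicesOn J i (no _)    = []

  choices : ∀ (J : Job m) → List (IntegralAssignment J)
  choices {m} J = concat (map (λ i → choicesOn J i (i ∈? feasible J)) (allFin m))

  -- Assignments contain functions and proofs, so the enumeration is complete only up to pointwise
  -- equality of fractions. The cost sees no more than that, by `cost-cong`.
  SameFrac : ∀ {J : Job m} → Assignment J → IntegralAssignment J → Set c
  SameFrac a b = ∀ i → frac a i ≡ frac (proj₁ b) i

  machine : ∀ {J : Job m} (a : Assignment J) → Integral a → ∃ λ i → frac a i ≡ 1ℝ
  machine {J = J} a integral with Fin.any? (λ i → frac a i ≟ 1ℝ)
  ... | yes found = found
  ... | no none   = contradiction (trans (sym (sum-zero zeros)) (total a)) 0≢1
    where
    zeros : ∀ i → when (i ∈? feasible J) (λ _ → frac a i) ≡ 0ℝ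
    zeros i with i ∈? feasible J | integral i
    ... | no _  | _        = refl
    ... | yes _ | inj₁ a≡0 = a≡0
    ... | yes _ | inj₂ a≡1 = contradiction (i , a≡1) none

  choices-complete : ∀ {J : Job m} (a : Assignment J) → Integral a → Any (SameFrac a) (choices J)
  choices-complete {m} {J} a integral with machine a integral
  ... | i , aᵢ≡1 = concat⁺ (map⁺ (lose (∈-allFin i) (on-machine (i ∈? feasible J))))
    where
    on-machine : ∀ i∈?S → Any (SameFrac a) (choicesOn J i i∈?S)
    on-machine (no i∉S)  = contradiction (trans (sym (supports a i i∉S)) aᵢ≡1) 0≢1
    on-machine (yes i∈S) = here same
      where
      same : ∀ k → frac a k ≡ indicator i k
      same k with k Fin.≟ i
      ... | yes refl = aᵢ≡1
      ... | no k≢i   = frac-unique a aᵢ≡1 i∈S k integral k≢i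

  candidates : (jobs : List (Job m)) → List (All IntegralAssignment jobs)
  candidates []         = [ [] ]
  candidates (J ∷ jobs) = cartesianProductWith _∷_ (choices J) (candidates jobs)

  candidates-complete : ∀ (jobs : List (Job m)) (x : Solution jobs) → (∀ j → Integral (x j)) →
    Any (λ y → ∀ j i → frac (x j) i ≡ frac (integralSolution y j) i) (candidates jobs)
  candidates-complete []         x integral = here λ ()
  candidates-complete (J ∷ jobs) x integral =
    cartesianProductWith⁺ _∷_ (λ x₀≗y₀ x≗y → λ { zero → x₀≗y₀ ; (suc j) → x≗y j })
      (choices-complete (x zero) (integral zero))
      (candidates-complete jobs (λ j → x (suc j)) (λ j → integral (suc j)))

  cost-cong : ∀ (jobs : List (Job m)) (order : SmithOrders jobs) {x y : Solution jobs} →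
    (∀ j i → frac (x j) i ≡ frac (y j) i) → cost jobs order x ≡ cost jobs order y
  cost-cong jobs order x≗y = sum-cong-≗ λ j → cong (w jobs j *_) (sum-cong-≗ λ i →
    when-cong (i ∈? S jobs j) λ i∈Sⱼ → cong₂ _*_ (x≗y j i) (cong (p jobs i j i∈Sⱼ +_) (sum-cong-≗ λ k →
    when-cong (i ∈? S jobs k) λ i∈Sₖ → when-cong (SmithOrder._≺?_ (order i) (k , i∈Sₖ) (j , i∈Sⱼ)) λ _ →
    cong (p jobs i k i∈Sₖ *_) (x≗y k i))))

  -- The reference solution y serves as the default value of the minimisation over the finitely many
  -- candidates, which makes the comparison with its cost immediate.
  optimum-exists : ∀ (jobs : List (Job m)) (order : SmithOrders jobs) (y : All IntegralAssignment jobs) →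
    ∃ λ (x : All IntegralAssignment jobs) →
      IsOPT jobs order (cost jobs order (integralSolution x)) ×
      cost jobs order (integralSolution x) ≤ cost jobs order (integralSolution y)
  optimum-exists jobs order y = best
    , ((integralSolution best , (λ j → proj₂ (lookupAll best j)) , refl)
      , λ x integral → Argmin.f[argmin]≤v⁺ {f = objective} y (candidates jobs)
          (inj₂ (Any.map (λ {z} x≗z → ≤-reflexive (sym (cost-cong jobs order {x} {integralSolution z} x≗z))) (candidates-complete jobs x integral))))
    , Argmin.f[argmin]≤f[⊤] {f = objective} y (candidates jobs)
    where
    objective : All IntegralAssignment jobs → ℝ
    objective z = cost jobs order (integralSolution z)

    best : All IntegralAssignment jobs
    best = Argmin.argmin objective y (candidates jobs)

  -- Here q is the sum of the squared b, and the optimum and the algorithm's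
  -- cost are v / 2 and at least l / 2.
  gap : ∀ {ε η n q l v} → 0ℝ ≤ ε → 0ℝ ≤ η → η + ε ≡ fromℕ 4 → 0ℝ ≤ n → lit 8 ≤ n * ε → n ≤ q →
        v ≤ n * n * q + n * q → lit 8 * (n * n) * q ≤ l + lit 4 * (n * n) * (1ℝ + q) →
        η * v ≤ l
  gap {ε} {η} {n} {q} {l} {v} 0≤ε 0≤η η+ε≡4 0≤n 8≤nε n≤q v≤ l≥ =
    -- The slack ε n² q has to absorb two errors: 4 n² from the tangent point `b 0`, and at most 4 n
    -- q from own processing in the optimum. Since n ≤ q, the former is at most 4 n q as well, and 8
    -- ≤ n ε pays for both. The summand added on both sides replaces subtractions.
    ≤-trans (*-monoʳ-≤ 0≤η v≤) (+-cancelˡ-≤ (ε * (n * n * q) + lit 4 * (n * n) * q) (begin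
      ε * (n * n * q) + lit 4 * (n * n) * q + η * (n * n * q + n * q)
        ≡⟨ solve 4 (λ ε η n q → ε :* (n :* n :* q) :+ con 4 :* (n :* n) :* q :+ η :* (n :* n :* q :+ n :* q)
                     := (η :+ ε) :* (n :* n :* q) :+ η :* (n :* q) :+ con 4 :* (n :* n) :* q) refl ε η n q ⟩
      (η + ε) * (n * n * q) + η * (n * q) + lit 4 * (n * n) * q
        ≤⟨ +-monoˡ-≤ _ (+-monoʳ-≤ _ (*-monoˡ-≤ 0≤nq (x≤x+y η 0≤ε))) ⟩
      (η + ε) * (n * n * q) + (η + ε) * (n * q) + lit 4 * (n * n) * q
        ≡⟨ cong (λ s → s * (n * n * q) + s * (n * q) + lit 4 * (n * n) * q) η+ε≡4 ⟩
      fromℕ 4 * (n * n * q) + fromℕ 4 * (n * q) + lit 4 * (n * n) * q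
        ≡⟨ solve 2 (λ n q → let four = con 1 :+ (con 1 :+ (con 1 :+ (con 1 :+ con 0))) in
             four :* (n :* n :* q) :+ four :* (n :* q) :+ con 4 :* (n :* n) :* q
               := con 8 :* (n :* n) :* q :+ con 4 :* (n :* q)) refl n q ⟩
      lit 8 * (n * n) * q + lit 4 * (n * q)
        ≤⟨ +-monoˡ-≤ _ l≥ ⟩
      l + lit 4 * (n * n) * (1ℝ + q) + lit 4 * (n * q)
        ≡⟨ solve 3 (λ l n q → l :+ con 4 :* (n :* n) :* (con 1 :+ q) :+ con 4 :* (n :* q)
                     := con 4 :* n :* n :+ (l :+ con 4 :* (n :* n) :* q :+ con 4 :* (n :* q))) refl l n q ⟩
      lit 4 * n * n + (l + lit 4 * (n * n) * q + lit 4 * (n * q))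
        ≤⟨ +-monoˡ-≤ _ (*-monoʳ-≤ (*-nonneg (lit-nonneg 4) 0≤n) n≤q) ⟩
      lit 4 * n * q + (l + lit 4 * (n * n) * q + lit 4 * (n * q))
        ≡⟨ solve 3 (λ l n q → con 4 :* n :* q :+ (l :+ con 4 :* (n :* n) :* q :+ con 4 :* (n :* q))
                     := con 8 :* (n :* q) :+ (con 4 :* (n :* n) :* q :+ l)) refl l n q ⟩
      lit 8 * (n * q) + (lit 4 * (n * n) * q + l)
        ≤⟨ +-monoˡ-≤ _ (*-monoˡ-≤ 0≤nq 8≤nε) ⟩
      n * ε * (n * q) + (lit 4 * (n * n) * q + l)
        ≡⟨ solve 4 (λ ε l n q → n :* ε :* (n :* q) :+ (con 4 :* (n :* n) :* q :+ l)
                     := ε :* (n :* n :* q) :+ con 4 :* (n :* n) :* q :+ l) refl ε l n q ⟩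
      ε * (n * n * q) + lit 4 * (n * n) * q + l ∎))
    where
    0≤nq : 0ℝ ≤ n * q
    0≤nq = *-nonneg 0≤n (≤-trans 0≤n n≤q)

  module Competitive {ε n : ℝ} {m : ℕ} (A : OnlineAlgorithm) (0≤ε : 0ℝ ≤ ε) (8≤nε : lit 8 ≤ n * ε)
    (1≤n : 1ℝ ≤ n) (n≤q : n ≤ squares m) (adversary : Attack n m ⊤ (λ _ → 0ℝ) (A m))
    (order : SmithOrders (Attack.jobs adversary)) where

    open Attack adversary

    private
      q = squares m

      0≤n : 0ℝ ≤ n
      0≤n = ≤-trans 0≤1 1≤n

      unitRatios : ∀ j → UnitRatio (lookup jobs j)
      unitRatios = lookupAll unitRatio

    optimum = optimum-exists jobs order opt

    best : Solution jobs
    best = integralSolution (proj₁ optimum)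

    OPT algorithm η : ℝ
    OPT       = cost jobs order best
    algorithm = cost jobs order (run jobs A)
    η         = fromℕ 4 - ε

    isOPT : IsOPT jobs order OPT
    isOPT = proj₁ (proj₂ optimum)

    squaredLoads : Solution jobs → ℝ
    squaredLoads x = sum λ i → load jobs x i * load jobs x i

    squaredLoads-nonneg : ∀ x → 0ℝ ≤ squaredLoads x
    squaredLoads-nonneg x = sum-nonneg λ i → square-nonneg (load jobs x i)

    2cost : ∀ (y : All IntegralAssignment jobs) → let κ = cost jobs order (integralSolution y) in
      κ + κ ≡ squaredLoads (integralSolution y) + n * q
    2cost y = trans
      (2cost-integral jobs unitRatios order (integralSolution y) λ j → proj₂ (lookupAll y j))
      (cong (squaredLoads (integralSolution y) +_) opt-weights)

    2OPT≤ : OPT + OPT ≤ n * n * q + n * q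
    2OPT≤ = ≤-trans (+-mono-≤ (proj₂ (proj₂ optimum)) (proj₂ (proj₂ optimum)))
      (≤-reflexive (trans (2cost opt) (cong (_+ n * q) opt-load)))

    -- Own processing alone contributes n q ≥ 1, so the loads of the unknown optimum need no lower
    -- bound beyond nonnegativity.
    1≤2OPT : 1ℝ ≤ OPT + OPT
    1≤2OPT = begin
      1ℝ             ≤⟨ 1≤n ⟩
      n              ≡⟨ *-identityʳ n ⟨
      n * 1ℝ         ≤⟨ *-monoʳ-≤ 0≤n (≤-trans 1≤n n≤q) ⟩
      n * q          ≤⟨ x≤x+y (n * q) (squaredLoads-nonneg best) ⟩
      n * q + squaredLoads best  ≡⟨ +-comm (n * q) _ ⟩
      squaredLoads best + n * q  ≡⟨ 2cost (proj₁ optimum) ⟨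
      OPT + OPT      ∎

    0≤OPT : 0ℝ ≤ OPT
    0≤OPT = halve (≤-trans (≤-reflexive (+-identityˡ 0ℝ)) (≤-trans 0≤1 1≤2OPT))

    OPT≢0 : OPT ≢ 0ℝ
    OPT≢0 OPT≡0 = 1≤⇒≢0 1≤2OPT (trans (cong₂ _+_ OPT≡0 OPT≡0) (+-identityˡ 0ℝ))

    squaredLoads≤2algorithm : squaredLoads (run jobs A) ≤ algorithm + algorithm
    squaredLoads≤2algorithm = squaredLoads≤2cost jobs unitRatios order (run jobs A)

    alg-squaredLoads : lit 8 * (n * n) * q ≤ squaredLoads (run jobs A) + lit 4 * (n * n) * (1ℝ + q)
    alg-squaredLoads = begin
      lit 8 * (n * n) * q
        ≡⟨ +-identityˡ _ ⟨
      0ℝ + lit 8 * (n * n) * q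
        ≡⟨ cong (_+ lit 8 * (n * n) * q) (trans (cong (lit 8 * n * b m *_) (trans (sumOn-⊤ {m} (λ _ → 0ℝ)) (sum-zero {m} λ _ → refl))) (zeroʳ _)) ⟨
      lit 8 * n * b m * sumOn {m} ⊤ (λ _ → 0ℝ) + lit 8 * (n * n) * q
        ≤⟨ alg-load ⟩
      sumOn ⊤ (λ i → final i * final i) + lit 4 * (n * n) * squares₀ m
        ≡⟨ cong (_+ lit 4 * (n * n) * squares₀ m) (trans (sumOn-⊤ {m} λ i → final i * final i)
             (sum-cong-≗ λ i → cong (λ t → t * t) (+-identityˡ (load jobs (run jobs A) i)))) ⟩
      squaredLoads (run jobs A) + lit 4 * (n * n) * squares₀ m
        ≤⟨ +-monoʳ-≤ _ (*-monoʳ-≤ (*-nonneg (lit-nonneg 4) (square-nonneg n)) (squares₀≤1+squares m)) ⟩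
      squaredLoads (run jobs A) + lit 4 * (n * n) * (1ℝ + q) ∎

    η+ε≡4 : η + ε ≡ fromℕ 4
    η+ε≡4 = trans (+-assoc (fromℕ 4) (- ε) ε) (trans (cong (fromℕ 4 +_) (-‿inverseˡ ε)) (+-identityʳ _))

    competitive : 0ℝ ≤ η ⊎ η ≤ 0ℝ → η * OPT ≤ algorithm
    competitive (inj₁ 0≤η) = halve (begin
      η * OPT + η * OPT          ≡⟨ distribˡ η OPT OPT ⟨
      η * (OPT + OPT)            ≤⟨ gap 0≤ε 0≤η η+ε≡4 0≤n 8≤nε n≤q 2OPT≤ alg-squaredLoads ⟩
      squaredLoads (run jobs A)  ≤⟨ squaredLoads≤2algorithm ⟩
      algorithm + algorithm      ∎)
    -- For ε ≥ 4 the factor is not positive and multiplying the upper bound on the optimum by it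
    -- would reverse the inequality; here the claim follows from the signs alone.
    competitive (inj₂ η≤0) = begin
      η * OPT      ≤⟨ *-monoˡ-≤ 0≤OPT η≤0 ⟩
      0ℝ * OPT     ≡⟨ zeroˡ OPT ⟩
      0ℝ           ≤⟨ halve (≤-trans (≤-reflexive (+-identityˡ 0ℝ)) (≤-trans (squaredLoads-nonneg (run jobs A)) squaredLoads≤2algorithm)) ⟩
      algorithm    ∎

    conclusion : ∃ λ (OPT : ℝ) → IsOPT jobs order OPT × (0ℝ < OPT) ×
      ((fromℕ 4 - ε) * OPT ≤ cost jobs order (run jobs A))
    conclusion = OPT , isOPT , (0≤OPT , λ 0≡OPT → OPT≢0 (sym 0≡OPT)) , competitive (≤-total 0ℝ η)

  lower-bound : (ε : ℝ) → 0ℝ < ε → (A : OnlineAlgorithm) →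
    ∃ λ (m : ℕ) → ∃ λ (jobs : List (Job m)) →
      (order : SmithOrders jobs) → ∃ λ (OPT : ℝ) →
        IsOPT jobs order OPT × (0ℝ < OPT) ×
        ((fromℕ 4 - ε) * OPT ≤ cost jobs order (run jobs A))
  lower-bound ε (0≤ε , 0≢ε) A = build (archimedean (lit 8 * ε ⁻¹))
    where
    build : (∃ λ k → lit 8 * ε ⁻¹ ≤ fromℕ k) →
      ∃ λ (m : ℕ) → ∃ λ (jobs : List (Job m)) →
        (order : SmithOrders jobs) → ∃ λ (OPT : ℝ) →
          IsOPT jobs order OPT × (0ℝ < OPT) ×
          ((fromℕ 4 - ε) * OPT ≤ cost jobs order (run jobs A))
    build (k , 8/ε≤k) = m′ , Attack.jobs adversary ,
      Competitive.conclusion A 0≤ε 8≤[k+1]ε (1≤fromℕ-suc k) (proj₂ unbounded) adversary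
      where
      -- The number of copies n = k + 1 is fixed before the number of machines, which is then taken
      -- so large that q ≥ n. The successor yields n ≥ 1 without inspecting k.
      unbounded = squares-unbounded (suc k)
      m′ = proj₁ unbounded

      adversary : Attack (fromℕ (suc k)) m′ ⊤ (λ _ → 0ℝ) (A m′)
      adversary = attack (suc k) m′ ⊤ (λ _ → 0ℝ) (A m′) (count-⊤ m′)

      8≤[k+1]ε : lit 8 ≤ fromℕ (suc k) * ε
      8≤[k+1]ε = begin
        lit 8                  ≡⟨ *-identityʳ (lit 8) ⟨
        lit 8 * 1ℝ             ≡⟨ cong (lit 8 *_) (*-inverseʳ ε λ ε≡0 → 0≢ε (sym ε≡0)) ⟨
        lit 8 * (ε * ε ⁻¹)     ≡⟨ solve 2 (λ ε r → con 8 :* (ε :* r) := con 8 :* r :* ε) refl ε (ε ⁻¹) ⟩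
        lit 8 * ε ⁻¹ * ε       ≤⟨ *-monoˡ-≤ 0≤ε (≤-trans 8/ε≤k (subst (fromℕ k ≤_) (+-comm _ 1ℝ) (x≤x+y _ 0≤1))) ⟩
        fromℕ (suc k) * ε      ∎

theorem1p4 : {c ℓ : Level} (ℛ : Reals c ℓ) →
    let open Reals ℛ
        open Scheduling ℛ
    in
    (ε : ℝ) → 0ℝ < ε → (A : OnlineAlgorithm) →
    ∃ λ (m : ℕ) → ∃ λ (jobs : List (Job m)) →
      (order : SmithOrders jobs) → ∃ λ (OPT : ℝ) →
        IsOPT jobs order OPT × (0ℝ < OPT) ×
        ((fromℕ 4 - ε) * OPT ≤ cost jobs order (run jobs A))
theorem1p4 = LowerBound.lower-bound
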